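{- For every weak composition $a$ of length $n$, \[\mathfrak{Q}_a=\sum_{\substack{b\ge a\\ \mathrm{flat}(b)=\mathrm{flat}(a)}}\mathcal{A}_b,\] where $b$ ranges over weak compositions of length $n$.
   Context: A weak composition of length $n$ is a sequence of $n$ nonnegative integers; $\mathrm{flat}(a)$ deletes zero parts; $b\ge a$ means $b_1+\cdots+b_i\ge a_1+\cdots+a_i$ for all $i$. $D(a)$: $a_i$ left-justified boxes in row $i$, row 1 lowest, columns numbered from the left. For a filling $S$ with positive integers, $x^{\mathrm{wt}(S)}=\prod_i x_i^{\#\{\text{entries } i\}}$. Demazure atom: a triple of $D(a)$ (rows $r<s$) is either Type A: boxes $\gamma=(r,c),\alpha=(r,c+1),\beta=(s,c+1)$ with $a_r\ge a_s$, or Type B: $\gamma=(s,c),\alpha=(s,c+1),\beta=(r,c)$ with $a_s>a_r$; it is an inversion triple if $\beta>\gamma\ge\alpha$ or $\gamma\ge\alpha>\beta$. $\mathcal{A}_a=\sum x^{\mathrm{wt}(S)}$ over fillings $S$ of $D(a)$ with positive integers whose rows weakly decrease left to right, whose column entries are distinct, all of whose triples are inversion triples, and whose first-column entry in each nonempty row $i$ equals $i$. Quasi-key tableau of shape $a$: filling of $D(a)$ with positive integers such that (1) entries weakly decrease along rows and no entry of row $i$ exceeds $i$; (2) entries in each column are distinct and increase going up the first column; (3) if an entry $i$ is above an entry $k$ in the same column with $i<k$, there is an entry $j$ immediately right of $k$ with $i<j$; (4) for two rows with the higher row strictly longer, if $i$ is in column $c$ of the lower row and $j$ in column $c+1$ of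 the higher row, then $i<j$. $\mathfrak{Q}_a=\sum x^{\mathrm{wt}(T)}$ over quasi-key tableaux $T$ of shape $a$. -}

module Defs where

open import Data.Bool.Base using (if_then_else_)
open import Data.Fin.Base as Fin using (Fin; toℕ)
import Data.Fin.Properties as Fin
open import Data.List.Base as List using (List; []; _∷_)
open import Data.List.Membership.Propositional using (_∈_)
open import Data.List.Membership.Propositional.Properties
  using (∈-cartesianProductWith⁺; ∈-filter⁺; ∈-filter⁻; ∈-upTo⁺)
open import Data.List.Properties using (∷-injective)
open import Data.List.Relation.Unary.All as All using (All; []; _∷_)
open import Data.List.Relation.Unary.Any using (here)
open import Data.List.Relation.Unary.Linked as Linked using (Linked; _∷_)
open import Data.List.Relation.Unary.Unique.Propositional using (Unique; []; _∷_)
import Data.List.Relation.Unary.Unique.Propositional.Properties as Unique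
open import Data.Maybe.Base using (Maybe; just; nothing)
open import Data.Nat.Base using (ℕ; zero; suc; _+_; _≤_; _≥_; _<_; z≤n; s≤s)
open import Data.Nat.ListAction using (sum)
open import Data.Nat.Properties
  using (_≟_; _≤?_; _<?_; ≤-trans; ≤-refl; ≤-reflexive; m≤m+n; m≤n+m)
open import Data.Product.Base using (∃; ∃-syntax; _×_; _,_; proj₁; proj₂)
open import Data.Sum.Base using (_⊎_)
open import Data.Vec.Base as Vec using (Vec; []; _∷_; lookup; toList)
import Data.Vec.Properties as Vec
open import Data.Vec.Relation.Unary.All as VecAll using ([]; _∷_)
open import Function.Base using (_∘_)
open import Relation.Binary.PropositionalEquality
  using (_≡_; _≢_; refl; subst)
open import Relation.Nullary.Decidable
  using (Dec; yes; no; does; map′; ¬?; _×-dec_; _⊎-dec_; _→-dec_)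
open import Relation.Unary using (Pred; Decidable)
open import Level using (0ℓ)

-- A polynomial in x₁, …, xₙ is given by its coefficients, indexed by exponent
-- vectors; two polynomials are equal when they agree pointwise.  Finite support is
-- not recorded: it is automatic for the finite sums of monomials used here.

Polynomial : ℕ → Set
Polynomial n = Vec ℕ n → ℕ

x^_ : ∀ {n} → Vec ℕ n → Polynomial n
(x^ w) v = if does (Vec.≡-dec _≟_ w v) then 1 else 0

-- Sums range over the elements satisfying a predicate; a listing contains each
-- of them exactly once.

record Listing {A : Set} (P : Pred A 0ℓ) : Set where
  field
    elements : List A
    unique   : Unique elements
    sound    : ∀ {x} → x ∈ elements → P x
    complete : ∀ {x} → P x → x ∈ elements

∑ : ∀ {A : Set} {P : Pred A 0ℓ} {n} → Listing P → (A → Polynomial n) → Polynomial n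
∑ L f v = sum (List.map (λ x → f x v) (Listing.elements L))

WeakComposition : ℕ → Set
WeakComposition n = Vec ℕ n

flat : ∀ {n} → WeakComposition n → List ℕ
flat a = List.filter (λ k → ¬? (k ≟ 0)) (toList a)

-- Row i : Fin n is the row numbered label i (row 1 lowest), and x_(label i) is
-- the variable whose exponent sits at position i.

label : ∀ {n} → Fin n → ℕ
label i = suc (toℕ i)

partialSum : ∀ {n} → WeakComposition n → Fin n → ℕ
partialSum a i = sum (List.take (label i) (toList a))

_⊵_ : ∀ {n} → WeakComposition n → WeakComposition n → Set
b ⊵ a = ∀ i → partialSum b i ≥ partialSum a i

record Above {n} (a b : WeakComposition n) : Set where
  field
    dominates : b ⊵ a
    sameFlat  : flat b ≡ flat a

-- A filling is the vector of its rows, lowest row first, each read from left to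
-- right.  T [ r , c ]≔ k says that the box in row r and column c + 1 exists and
-- has entry k; columns are thus counted from 0.

Filling : ℕ → Set
Filling n = Vec (List ℕ) n

entry : List ℕ → ℕ → Maybe ℕ
entry xs c = List.head (List.drop c xs)

_[_,_]≔_ : ∀ {n} → Filling n → Fin n → ℕ → ℕ → Set
T [ r , c ]≔ k = entry (lookup T r) c ≡ just k

wt : ∀ {n} → Filling n → Vec ℕ n
wt T = Vec.tabulate λ i → List.length (List.filter (_≟ label i) (List.concat (toList T)))

record IsFilling {n} (a : WeakComposition n) (T : Filling n) : Set where
  field
    shape    : Vec.map List.length T ≡ a
    positive : VecAll.All (All (0 <_)) T

RowsDecrease : ∀ {n} → Filling n → Set
RowsDecrease = VecAll.All (Linked _≥_)

ColumnsDistinct : ∀ {n} → Filling n → Set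
ColumnsDistinct T = ∀ r s → r Fin.< s →
  ∀ c k → T [ r , c ]≔ k → ∀ l → T [ s , c ]≔ l → k ≢ l

Inversion : (α β γ : ℕ) → Set
Inversion α β γ = (γ < β × α ≤ γ) ⊎ (α ≤ γ × β < α)

record IsAtomFilling {n} (a : WeakComposition n) (T : Filling n) : Set where
  field
    isFilling       : IsFilling a T
    rowsDecrease    : RowsDecrease T
    columnsDistinct : ColumnsDistinct T
    typeA           : ∀ r s → r Fin.< s → lookup a r ≥ lookup a s →
                      ∀ c γ → T [ r , c ]≔ γ → ∀ α → T [ r , suc c ]≔ α →
                      ∀ β → T [ s , suc c ]≔ β → Inversion α β γ
    typeB           : ∀ r s → r Fin.< s → lookup a r < lookup a s →
                      ∀ c γ → T [ s , c ]≔ γ → ∀ α → T [ s , suc c ]≔ α →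
                      ∀ β → T [ r , c ]≔ β → Inversion α β γ
    firstColumn     : ∀ r k → T [ r , 0 ]≔ k → k ≡ label r

record IsQuasiKey {n} (a : WeakComposition n) (T : Filling n) : Set where
  field
    isFilling            : IsFilling a T
    rowsDecrease         : RowsDecrease T
    rowsBounded          : ∀ r → All (_≤ label r) (lookup T r)
    columnsDistinct      : ColumnsDistinct T
    firstColumnIncreases : ∀ r s → r Fin.< s →
                           ∀ k → T [ r , 0 ]≔ k → ∀ l → T [ s , 0 ]≔ l → k < l
    descent              : ∀ r s → r Fin.< s →
                           ∀ c k → T [ r , c ]≔ k → ∀ i → T [ s , c ]≔ i → i < k →
                           ∃[ j ] T [ r , suc c ]≔ j × i < j
    longerAbove          : ∀ r s → r Fin.< s → lookup a r < lookup a s →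
                           ∀ c i → T [ r , c ]≔ i → ∀ j → T [ s , suc c ]≔ j → i < j

private
  ∀entry? : ∀ {P : ℕ → Set} (m : Maybe ℕ) → Decidable P → Dec (∀ k → m ≡ just k → P k)
  ∀entry? nothing  P? = yes λ _ ()
  ∀entry? (just x) P? = map′ (λ { p _ refl → p }) (λ f → f x refl) (P? x)

  ∃entry? : ∀ {P : ℕ → Set} (m : Maybe ℕ) → Decidable P → Dec (∃[ k ] m ≡ just k × P k)
  ∃entry? nothing  P? = no λ { (_ , () , _) }
  ∃entry? (just x) P? = map′ (λ p → x , refl , p) (λ { (_ , refl , p) → p }) (P? x)

  ∀row? : ∀ {P : ℕ → ℕ → Set} xs → (∀ c k → Dec (P c k)) →
          Dec (∀ c k → entry xs c ≡ just k → P c k)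
  ∀row? []       P? = yes λ { zero _ () ; (suc _) _ () }
  ∀row? (x ∷ xs) P? = map′
    (λ { (p , f) zero _ refl → p ; (p , f) (suc c) → f c })
    (λ f → f 0 x refl , λ c → f (suc c))
    (P? 0 x ×-dec ∀row? xs (λ c → P? (suc c)))

  ∀pair? : ∀ {n} {P : Fin n → Fin n → Set} → (∀ r s → Dec (P r s)) →
           Dec (∀ r s → r Fin.< s → P r s)
  ∀pair? P? = Fin.all? λ r → Fin.all? λ s → (r Fin.<? s) →-dec P? r s

above? : ∀ {n} (a : WeakComposition n) → Decidable (Above a)
above? a b = map′
  (λ { (d , e) → record { dominates = d ; sameFlat = e } })
  (λ p → Above.dominates p , Above.sameFlat p)
  (Fin.all? (λ i → partialSum a i ≤? partialSum b i)
    ×-dec List.≡-dec _≟_ (flat b) (flat a))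
  where import Data.List.Properties as List

isFilling? : ∀ {n} (a : WeakComposition n) → Decidable (IsFilling a)
isFilling? a T = map′
  (λ { (s , p) → record { shape = s ; positive = p } })
  (λ f → IsFilling.shape f , IsFilling.positive f)
  (Vec.≡-dec _≟_ (Vec.map List.length T) a ×-dec VecAll.all? (All.all? (0 <?_)) T)

rowsDecrease? : ∀ {n} → Decidable (RowsDecrease {n})
rowsDecrease? = VecAll.all? (Linked.linked? (λ k l → l ≤? k))

columnsDistinct? : ∀ {n} → Decidable (ColumnsDistinct {n})
columnsDistinct? T = ∀pair? λ r s → ∀row? (lookup T r) λ c k →
  ∀entry? (entry (lookup T s) c) λ l → ¬? (k ≟ l)

inversion? : ∀ α β γ → Dec (Inversion α β γ)
inversion? α β γ = ((γ <? β) ×-dec (α ≤? γ)) ⊎-dec ((α ≤? γ) ×-dec (β <? α))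

isAtomFilling? : ∀ {n} (a : WeakComposition n) → Decidable (IsAtomFilling a)
isAtomFilling? a T = map′
  (λ { (f , d , c , A , B , e) → record
       { isFilling = f ; rowsDecrease = d ; columnsDistinct = c
       ; typeA = A ; typeB = B ; firstColumn = e } })
  (λ t → let open IsAtomFilling t in
         isFilling , rowsDecrease , columnsDistinct , typeA , typeB , firstColumn)
  (isFilling? a T ×-dec rowsDecrease? T ×-dec columnsDistinct? T
    ×-dec ∀pair? (λ r s → (lookup a s ≤? lookup a r) →-dec
            ∀row? (lookup T r) λ c γ → ∀entry? (entry (lookup T r) (suc c)) λ α →
            ∀entry? (entry (lookup T s) (suc c)) λ β → inversion? α β γ)
    ×-dec ∀pair? (λ r s → (lookup a r <? lookup a s) →-dec
            ∀row? (lookup T s) λ c γ → ∀entry? (entry (lookup T s) (suc c)) λ α →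
            ∀entry? (entry (lookup T r) c) λ β → inversion? α β γ)
    ×-dec Fin.all? (λ r → ∀entry? (entry (lookup T r) 0) λ k → k ≟ label r))

isQuasiKey? : ∀ {n} (a : WeakComposition n) → Decidable (IsQuasiKey a)
isQuasiKey? a T = map′
  (λ { (f , d , b , c , i , e , l) → record
       { isFilling = f ; rowsDecrease = d ; rowsBounded = b ; columnsDistinct = c
       ; firstColumnIncreases = i ; descent = e ; longerAbove = l } })
  (λ t → let open IsQuasiKey t in
         isFilling , rowsDecrease , rowsBounded , columnsDistinct
         , firstColumnIncreases , descent , longerAbove)
  (isFilling? a T ×-dec rowsDecrease? T
    ×-dec Fin.all? (λ r → All.all? (_≤? label r) (lookup T r))
    ×-dec columnsDistinct? T
    ×-dec ∀pair? (λ r s → ∀entry? (entry (lookup T r) 0) λ k →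
            ∀entry? (entry (lookup T s) 0) λ l → k <? l)
    ×-dec ∀pair? (λ r s → ∀row? (lookup T r) λ c k →
            ∀entry? (entry (lookup T s) c) λ i → (i <? k) →-dec
            ∃entry? (entry (lookup T r) (suc c)) λ j → i <? j)
    ×-dec ∀pair? (λ r s → (lookup a r <? lookup a s) →-dec
            ∀row? (lookup T r) λ c i →
            ∀entry? (entry (lookup T s) (suc c)) λ j → i <? j))

listing : ∀ {A : Set} {P : Pred A 0ℓ} → Decidable P → (xs : List A) → Unique xs →
          (∀ {x} → P x → x ∈ xs) → Listing P
listing P? xs u c = record
  { elements = List.filter P? xs
  ; unique   = Unique.filter⁺ P? u
  ; sound    = λ x∈ → proj₂ (∈-filter⁻ P? {xs = xs} x∈)
  ; complete = λ p → ∈-filter⁺ P? (c p) p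
  }

compositionsUpTo : ℕ → ∀ n → List (Vec ℕ n)
compositionsUpTo m zero    = List.[ [] ]
compositionsUpTo m (suc n) =
  List.cartesianProductWith _∷_ (List.upTo (suc m)) (compositionsUpTo m n)

rowsUpTo : ℕ → ℕ → List (List ℕ)
rowsUpTo m zero    = List.[ [] ]
rowsUpTo m (suc k) = List.cartesianProductWith _∷_ (List.upTo (suc m)) (rowsUpTo m k)

fillingsUpTo : ℕ → ∀ {n} → WeakComposition n → List (Filling n)
fillingsUpTo m []      = List.[ [] ]
fillingsUpTo m (k ∷ a) = List.cartesianProductWith _∷_ (rowsUpTo m k) (fillingsUpTo m a)

private
  compositionsUpTo-unique : ∀ m n → Unique (compositionsUpTo m n)
  compositionsUpTo-unique m zero    = [] ∷ []
  compositionsUpTo-unique m (suc n) = Unique.cartesianProductWith⁺ _∷_ Vec.∷-injective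
    (Unique.upTo⁺ (suc m)) (compositionsUpTo-unique m n)

  rowsUpTo-unique : ∀ m k → Unique (rowsUpTo m k)
  rowsUpTo-unique m zero    = [] ∷ []
  rowsUpTo-unique m (suc k) = Unique.cartesianProductWith⁺ _∷_ ∷-injective
    (Unique.upTo⁺ (suc m)) (rowsUpTo-unique m k)

  fillingsUpTo-unique : ∀ m {n} (a : WeakComposition n) → Unique (fillingsUpTo m a)
  fillingsUpTo-unique m []      = [] ∷ []
  fillingsUpTo-unique m (k ∷ a) = Unique.cartesianProductWith⁺ _∷_ Vec.∷-injective
    (rowsUpTo-unique m k) (fillingsUpTo-unique m a)

  ∈-compositionsUpTo : ∀ {m n} {b : Vec ℕ n} → VecAll.All (_≤ m) b →
                       b ∈ compositionsUpTo m n
  ∈-compositionsUpTo []      = here refl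
  ∈-compositionsUpTo (p ∷ q) =
    ∈-cartesianProductWith⁺ _∷_ (∈-upTo⁺ (s≤s p)) (∈-compositionsUpTo q)

  ∈-rowsUpTo : ∀ {m xs} → All (_≤ m) xs → xs ∈ rowsUpTo m (List.length xs)
  ∈-rowsUpTo []      = here refl
  ∈-rowsUpTo (p ∷ q) = ∈-cartesianProductWith⁺ _∷_ (∈-upTo⁺ (s≤s p)) (∈-rowsUpTo q)

  ∈-fillingsUpTo : ∀ {m n} (T : Filling n) → (∀ r → All (_≤ m) (lookup T r)) →
                   T ∈ fillingsUpTo m (Vec.map List.length T)
  ∈-fillingsUpTo []       p = here refl
  ∈-fillingsUpTo (xs ∷ T) p = ∈-cartesianProductWith⁺ _∷_
    (∈-rowsUpTo (p Fin.zero)) (∈-fillingsUpTo T (p ∘ Fin.suc))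

  parts≤sum-flat : ∀ {n} (b : WeakComposition n) → VecAll.All (_≤ sum (flat b)) b
  parts≤sum-flat []          = []
  parts≤sum-flat (zero ∷ b)  = z≤n ∷ parts≤sum-flat b
  parts≤sum-flat (suc k ∷ b) =
    m≤m+n (suc k) _ ∷ VecAll.map (λ p → ≤-trans p (m≤n+m _ (suc k))) (parts≤sum-flat b)

  row≤first : ∀ {m xs} → Linked _≥_ xs → (∀ k → entry xs 0 ≡ just k → k ≤ m) →
              All (_≤ m) xs
  row≤first {xs = []}         _         _ = []
  row≤first {xs = x ∷ []}     _         h = h x refl ∷ []
  row≤first {xs = x ∷ y ∷ xs} (y≤x ∷ l) h =
    h x refl ∷ row≤first l (λ { _ refl → ≤-trans y≤x (h x refl) })

compositionsAbove : ∀ {n} (a : WeakComposition n) → Listing (Above a)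
compositionsAbove {n} a = listing (above? a)
  (compositionsUpTo (sum (flat a)) n)
  (compositionsUpTo-unique (sum (flat a)) n)
  (λ {b} p → ∈-compositionsUpTo
    (subst (λ l → VecAll.All (_≤ sum l) b) (Above.sameFlat p) (parts≤sum-flat b)))

atomFillings : ∀ {n} (a : WeakComposition n) → Listing (IsAtomFilling a)
atomFillings {n} a = listing (isAtomFilling? a) (fillingsUpTo n a) (fillingsUpTo-unique n a)
  λ {T} t → let open IsAtomFilling t in
    subst (λ s → T ∈ fillingsUpTo n s) (IsFilling.shape isFilling)
      (∈-fillingsUpTo T λ r → row≤first (VecAll.lookup⁺ rowsDecrease r)
        λ k e → ≤-trans (≤-reflexive (firstColumn r k e)) (Fin.toℕ<n r))
  where import Data.Vec.Relation.Unary.All.Properties as VecAll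

quasiKeyTableaux : ∀ {n} (a : WeakComposition n) → Listing (IsQuasiKey a)
quasiKeyTableaux {n} a = listing (isQuasiKey? a) (fillingsUpTo n a) (fillingsUpTo-unique n a)
  λ {T} t → let open IsQuasiKey t in
    subst (λ s → T ∈ fillingsUpTo n s) (IsFilling.shape isFilling)
      (∈-fillingsUpTo T λ r → All.map (λ p → ≤-trans p (Fin.toℕ<n r)) (rowsBounded r))

𝒜 : ∀ {n} → WeakComposition n → Polynomial n
𝒜 a = ∑ (atomFillings a) λ S → x^ wt S

𝔔 : ∀ {n} → WeakComposition n → Polynomial n
𝔔 a = ∑ (quasiKeyTableaux a) λ T → x^ wt T

{-# OPTIONS --safe #-}

-- Quasi-key tableaux T and atom fillings S are matched when, column by column, they
-- contain the same entries; this preserves the weight.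
--
-- Existence.  Given its first column, an atom filling is produced from the sets of
-- entries of its columns by a greedy rule: from left to right, the rows from bottom to
-- top take the largest remaining entry of the next column not exceeding their current
-- one.  A quasi-key tableau is produced by the mirror rule: from right to left, the
-- rows, longest first and ties from the bottom, take the smallest remaining entry that
-- is at least their current one.  In either rule a row that takes the entry of another
-- row hands over its own, so the rule cannot fail once some filling with weakly
-- decreasing rows has these columns.  Finally the rows of T, kept in order, are moved
-- down so that the one starting with i is row i; the shape b so obtained satisfies
-- flat b = flat a, and b ⊵ a says precisely that no row starts above its label.
--
-- Uniqueness and equality of shapes.  The greedy rules make S extremal among all
-- fillings with the same columns and first column: for all j, c, v, it has the most
-- entries ≥ v in column c and rows < j.  Likewise T has the most entries ≤ v in column
-- c and an initial segment of the rows, longest first.  Moreover, for every ℓ, the rows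
-- of T reaching column ℓ have in each column at least as many entries ≤ v as those of S;
-- in the first column this bounds the shape of S in the direction opposite to the
-- extremality of S, so the two shapes agree.
module Submission where

open import Defs
open import Data.Bool.Base using (if_then_else_; true; false)
open import Data.Empty using (⊥; ⊥-elim)
open import Data.Fin.Base as Fin using (Fin; zero; suc; toℕ)
open import Data.Fin.Permutation as Perm
  using (Permutation′; _⟨$⟩ʳ_; _⟨$⟩ˡ_; _∘ₚ_; lift₀; transpose)
import Data.Fin.Properties as Fin
open import Data.List.Base as List using (List; []; _∷_)
open import Data.List.Membership.Propositional using (_∈_)
open import Data.List.Membership.Propositional.Properties
  using (∈-∃++; ∈-concat⁺′; ∈-concat⁻′; ∈-map⁺; ∈-map⁻)
import Data.List.Properties as List
open import Data.List.Relation.Binary.Disjoint.Propositional using (Disjoint)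
open import Data.List.Relation.Binary.Permutation.Propositional using (↭-sym; ↭⇒↭ₛ)
open import Data.List.Relation.Binary.Permutation.Propositional.Properties
  using (shift; map⁺; ∈-resp-↭)
open import Data.List.Relation.Binary.Permutation.Setoid.Properties using (Unique-resp-↭)
open import Data.List.Relation.Unary.All as All using (All; []; _∷_)
import Data.List.Relation.Unary.All.Properties as All
open import Data.List.Relation.Unary.AllPairs as AllPairs using (AllPairs; []; _∷_)
import Data.List.Relation.Unary.AllPairs.Properties as AllPairs
open import Data.List.Relation.Unary.Any using (here; there)
open import Data.List.Relation.Unary.Linked using (Linked; []; [-]; _∷_)
open import Data.List.Relation.Unary.Unique.Propositional using (Unique)
import Data.List.Relation.Unary.Unique.Propositional.Properties as Unique
open import Data.Maybe.Base using (just)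
open import Data.Maybe.Properties using (just-injective)
open import Data.Nat.Base
  using (ℕ; zero; suc; _+_; _*_; _∸_; _≤_; _≥_; _<_; z≤n; s≤s; s≤s⁻¹; z<s)
open import Data.Nat.ListAction using (sum)
open import Data.Nat.ListAction.Properties using (sum-++; sum-↭)
open import Data.Nat.Properties
open import Data.Product.Base using (∃-syntax; _×_; _,_; proj₁; proj₂; map₂)
open import Data.Sum.Base as Sum using (_⊎_; inj₁; inj₂; [_,_]′)
open import Data.Unit.Base using (⊤; tt)
open import Data.Vec.Base as Vec using (Vec; []; _∷_; lookup; toList)
import Data.Vec.Properties as Vec
import Data.Vec.Relation.Unary.All.Properties as VecAll
open import Function.Base using (_∘_; id; case_of_)
open import Relation.Binary.Definitions using (Total; Transitive; tri<; tri≈; tri>)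
open import Relation.Binary.PropositionalEquality
  using (_≡_; _≢_; _≗_; refl; sym; trans; cong; cong₂; subst; subst₂; setoid; module ≡-Reasoning)
open import Relation.Nullary.Decidable
  using (Dec; yes; no; does; ¬?; _×-dec_; _⊎-dec_; dec-false)
open import Relation.Nullary.Negation using (¬_; contradiction)
open import Algebra.Properties.CommutativeMonoid.Sum +-0-commutativeMonoid
  using (∑-distrib-+; ∑-comm; sum-permute; sum-cong-≗) renaming (sum to sumᶠ)

-- Counting

sumᶠ-mono : ∀ {n} {f g : Fin n → ℕ} → (∀ i → f i ≤ g i) → sumᶠ f ≤ sumᶠ g
sumᶠ-mono {zero}  h = z≤n
sumᶠ-mono {suc n} h = +-mono-≤ (h zero) (sumᶠ-mono (h ∘ suc))

sumᶠ-mono-< : ∀ {n} {f g : Fin n → ℕ} → (∀ i → f i ≤ g i) →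
              ∀ i → f i < g i → sumᶠ f < sumᶠ g
sumᶠ-mono-< h zero    lt = +-mono-<-≤ lt (sumᶠ-mono (h ∘ suc))
sumᶠ-mono-< h (suc i) lt = +-mono-≤-< (h zero) (sumᶠ-mono-< (h ∘ suc) i lt)

≤sumᶠ : ∀ {n} (f : Fin n → ℕ) i → f i ≤ sumᶠ f
≤sumᶠ f zero    = m≤m+n _ _
≤sumᶠ f (suc i) = ≤-trans (≤sumᶠ (f ∘ suc) i) (m≤n+m _ (f zero))

[_] : {P : Set} → Dec P → ℕ
[ p? ] = if does p? then 1 else 0

module _ {P Q : Set} where

  []-mono : (P → Q) → (p? : Dec P) (q? : Dec Q) → [ p? ] ≤ [ q? ]
  []-mono h (no _)  q?       = z≤n
  []-mono h (yes _) (yes _)  = ≤-refl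
  []-mono h (yes p) (no ¬q)  = ⊥-elim (¬q (h p))

  []-mono-< : ¬ P → Q → (p? : Dec P) (q? : Dec Q) → [ p? ] < [ q? ]
  []-mono-< ¬p q (yes p) _       = ⊥-elim (¬p p)
  []-mono-< ¬p q (no _)  (yes _) = ≤-refl
  []-mono-< ¬p q (no _)  (no ¬q) = ⊥-elim (¬q q)

module _ {P Q R : Set} where

  []-cover : (P → Q ⊎ R) → (p? : Dec P) (q? : Dec Q) (r? : Dec R) → [ p? ] ≤ [ q? ] + [ r? ]
  []-cover h (no _)  _       _       = z≤n
  []-cover h (yes _) (yes _) _       = s≤s z≤n
  []-cover h (yes _) (no _)  (yes _) = ≤-refl
  []-cover h (yes p) (no ¬q) (no ¬r) = ⊥-elim ([ ¬q , ¬r ]′ (h p))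

  []-disjoint : (Q → P) → (R → P) → (Q → R → ⊥) →
                (p? : Dec P) (q? : Dec Q) (r? : Dec R) → [ q? ] + [ r? ] ≤ [ p? ]
  []-disjoint f g h p?      (yes q) (yes r) = ⊥-elim (h q r)
  []-disjoint f g h p?      (yes q) (no _)  = []-mono f (yes q) p?
  []-disjoint f g h p?      (no _)  (yes r) = []-mono g (yes r) p?
  []-disjoint f g h p?      (no _)  (no _)  = z≤n

opaque

  # : ∀ {n} {P : Fin n → Set} → (∀ i → Dec (P i)) → ℕ
  # P? = sumᶠ λ i → [ P? i ]

  #-empty : ∀ {n} {P : Fin n → Set} (P? : ∀ i → Dec (P i)) → (∀ i → ¬ P i) → # P? ≡ 0
  #-empty {zero}  P? h = refl
  #-empty {suc n} P? h with P? zero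
  ... | yes p = ⊥-elim (h zero p)
  ... | no _  = #-empty (P? ∘ suc) (h ∘ suc)

module _ {n} {P Q : Fin n → Set} (P? : ∀ i → Dec (P i)) (Q? : ∀ i → Dec (Q i)) where
  opaque
    unfolding #

    #-mono : (∀ i → P i → Q i) → # P? ≤ # Q?
    #-mono h = sumᶠ-mono λ i → []-mono (h i) (P? i) (Q? i)

    #-mono-< : (∀ i → P i → Q i) → ∀ i → ¬ P i → Q i → # P? < # Q?
    #-mono-< h i ¬p q =
      sumᶠ-mono-< (λ i → []-mono (h i) (P? i) (Q? i)) i ([]-mono-< ¬p q (P? i) (Q? i))

module _ {n} {P Q R : Fin n → Set}
         (P? : ∀ i → Dec (P i)) (Q? : ∀ i → Dec (Q i)) (R? : ∀ i → Dec (R i)) where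
  opaque
    unfolding #

    #-cover : (∀ i → P i → Q i ⊎ R i) → # P? ≤ # Q? + # R?
    #-cover h = ≤-trans
      (sumᶠ-mono λ i → []-cover (h i) (P? i) (Q? i) (R? i))
      (≤-reflexive (∑-distrib-+ (λ i → [ Q? i ]) (λ i → [ R? i ])))

    #-disjoint : (∀ i → Q i → P i) → (∀ i → R i → P i) → (∀ i → Q i → R i → ⊥) →
                 # Q? + # R? ≤ # P?
    #-disjoint f g h = ≤-trans
      (≤-reflexive (sym (∑-distrib-+ (λ i → [ Q? i ]) (λ i → [ R? i ]))))
      (sumᶠ-mono λ i → []-disjoint (f i) (g i) (h i) (P? i) (Q? i) (R? i))

#-positive : ∀ {n} {P : Fin n → Set} (P? : ∀ i → Dec (P i)) i → P i → 0 < # P?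
#-positive P? i p = subst (_< # P?) (#-empty {P = λ _ → ⊥} (λ _ → no id) λ _ → id)
  (#-mono-< {P = λ _ → ⊥} (λ _ → no id) P? (λ _ ()) i id p)

-- Adding `i` to `B` raises the count of `P` and, if `P′ i` failed, not that of `P′`; the two
-- inequalities then close a cycle with a strict step.
separate : ∀ {n} {B B′ P P′ : Fin n → Set}
  (B? : ∀ i → Dec (B i)) (B′? : ∀ i → Dec (B′ i))
  (P? : ∀ i → Dec (P i)) (P′? : ∀ i → Dec (P′ i)) i →
  (∀ r → B r → B′ r) → (∀ r → B′ r → B r ⊎ r ≡ i) → ¬ B i → B′ i →
  # (λ r → B? r ×-dec P′? r) ≤ # (λ r → B? r ×-dec P? r) →
  # (λ r → B′? r ×-dec P? r) ≤ # (λ r → B′? r ×-dec P′? r) →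
  P i → P′ i
separate B? B′? P? P′? i B⊆B′ B′⊆ ¬b b′ le le′ p with P′? i
... | yes p′ = p′
... | no ¬p′ = contradiction lt (<-irrefl refl)
  where
  lt : # (λ r → B? r ×-dec P? r) < # (λ r → B? r ×-dec P? r)
  lt = <-≤-trans
    (#-mono-< _ (λ r → B′? r ×-dec P? r) (λ r (b , q) → B⊆B′ r b , q) i (¬b ∘ proj₁) (b′ , p))
    (≤-trans le′ (≤-trans
      (#-mono (λ r → B′? r ×-dec P′? r) (λ r → B? r ×-dec P′? r)
        λ r (b , q) → [ (λ b → b , q) , (λ { refl → ⊥-elim (¬p′ q) }) ]′ (B′⊆ r b))
      le))

≡-from-thresholds : ∀ {x y} → (∀ v → 0 < v → v ≤ x → v ≤ y) → (∀ v → 0 < v → v ≤ y → v ≤ x) → x ≡ y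
≡-from-thresholds {zero}  {zero}  f g = refl
≡-from-thresholds {zero}  {suc y} f g = ⊥-elim (n≮0 (g _ z<s ≤-refl))
≡-from-thresholds {suc x} {zero}  f g = ⊥-elim (n≮0 (f _ z<s ≤-refl))
≡-from-thresholds {suc x} {suc y} f g = ≤-antisym (f _ z<s ≤-refl) (g _ z<s ≤-refl)

-- Equal multisets of nonzero entries: f 0 ≡ 0 keeps the absent boxes from contributing.
record _≈ᶜ_ {n} (Y Z : Fin n → ℕ) : Set where
  field
    sums : ∀ (f : ℕ → ℕ) → f 0 ≡ 0 → sumᶠ (f ∘ Y) ≡ sumᶠ (f ∘ Z)

open _≈ᶜ_

≈ᶜ-sym : ∀ {n} {Y Z : Fin n → ℕ} → Y ≈ᶜ Z → Z ≈ᶜ Y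
≈ᶜ-sym e .sums f f0 = sym (e .sums f f0)

≈ᶜ-trans : ∀ {n} {X Y Z : Fin n → ℕ} → X ≈ᶜ Y → Y ≈ᶜ Z → X ≈ᶜ Z
≈ᶜ-trans e e′ .sums f f0 = trans (e .sums f f0) (e′ .sums f f0)

opaque
  unfolding #

  ≈ᶜ-# : ∀ {n} {Y Z : Fin n → ℕ} {P : ℕ → Set} (P? : ∀ v → Dec (P v)) → ¬ P 0 →
         Y ≈ᶜ Z → # (λ r → P? (Y r)) ≡ # (λ r → P? (Z r))
  ≈ᶜ-# P? ¬P0 e = e .sums (λ v → [ P? v ]) (cong (λ b → if b then 1 else 0) (dec-false (P? 0) ¬P0))

-- Absent boxes are 0 and are excluded from `AtMost` explicitly; `AtLeast` excludes them at every
-- positive threshold, and only such thresholds are compared.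
AtMost AtLeast : ∀ {n} → (Fin n → Set) → (Fin n → ℕ) → ℕ → Fin n → Set
AtMost  B Y v r = B r × 0 < Y r × Y r ≤ v
AtLeast B Y v r = B r × v ≤ Y r

module _ {n} {B : Fin n → Set} (B? : ∀ r → Dec (B r)) where

  atMost? : ∀ Y v r → Dec (AtMost B Y v r)
  atMost? Y v r = B? r ×-dec (0 <? Y r) ×-dec (Y r ≤? v)

  atLeast? : ∀ Y v r → Dec (AtLeast B Y v r)
  atLeast? Y v r = B? r ×-dec (v ≤? Y r)

module _ {n} {B B′ : Fin n → Set} (B? : ∀ r → Dec (B r)) (B′? : ∀ r → Dec (B′ r))
         {Y Y′ : Fin n → ℕ} (Y≈Y′ : Y ≈ᶜ Y′) where

  private
    values : ∀ {v} → 0 < v → (∀ r → Y′ r ≡ v → B′ r) →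
             # (λ r → Y r ≟ v) ≤ # (λ r → B′? r ×-dec (Y′ r ≟ v))
    values {v} 0<v h = ≤-trans
      (≤-reflexive (≈ᶜ-# (_≟ v) (λ { refl → n≮0 0<v }) Y≈Y′))
      (#-mono _ _ λ r e → h r e , e)

  -- It suffices to compare the counts at those v which occur in Y′ outside B′.
  atMost-≤ : (∀ v r → ¬ B′ r → Y′ r ≡ v → 0 < v → # (atMost? B? Y v) ≤ # (atMost? B′? Y′ v)) →
             ∀ v → # (atMost? B? Y v) ≤ # (atMost? B′? Y′ v)
  atMost-≤ h zero    = ≤-trans
    (≤-reflexive (#-empty (atMost? B? Y 0) λ r (_ , p , q) → n≮0 (≤-trans p q))) z≤n
  atMost-≤ h (suc v) with Fin.any? (λ r → ¬? (B′? r) ×-dec (Y′ r ≟ suc v))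
  ... | yes (r , ¬b , e) = h (suc v) r ¬b e z<s
  -- Every `suc v` of `Y′` now lies in `B′`, so the step from `v` to `suc v` adds all its
  -- occurrences on the right and no more than these on the left.
  ... | no none = begin
    # (atMost? B? Y (suc v))
      ≤⟨ #-cover _ (atMost? B? Y v) (λ r → Y r ≟ suc v)
           (λ r (b , p , q) → [ (λ lt → inj₁ (b , p , s≤s⁻¹ lt)) , inj₂ ]′ (m≤n⇒m<n∨m≡n q)) ⟩
    # (atMost? B? Y v) + # (λ r → Y r ≟ suc v)
      ≤⟨ +-mono-≤ (atMost-≤ h v) (values z<s inB′) ⟩
    # (atMost? B′? Y′ v) + # (λ r → B′? r ×-dec (Y′ r ≟ suc v))
      ≤⟨ #-disjoint (atMost? B′? Y′ (suc v)) _ _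
           (λ r (b , p , q) → b , p , m≤n⇒m≤1+n q)
           (λ r (b , e) → b , subst (0 <_) (sym e) z<s , ≤-reflexive e)
           (λ r (_ , _ , q) (_ , e) → 1+n≰n (subst (_≤ v) e q)) ⟩
    # (atMost? B′? Y′ (suc v)) ∎
    where
    open ≤-Reasoning
    inB′ : ∀ r → Y′ r ≡ suc v → B′ r
    inB′ r e with B′? r
    ... | yes b = b
    ... | no ¬b = ⊥-elim (none (r , ¬b , e))

  -- The same reduction by descending thresholds: the induction starts beyond the sum of `Y`, where
  -- the left count is 0, and `d` in `go` is the number of steps left to get there.
  atLeast-≤ : (∀ v r → ¬ B′ r → Y′ r ≡ v → 0 < v → # (atLeast? B? Y v) ≤ # (atLeast? B′? Y′ v)) →
              ∀ v → 0 < v → # (atLeast? B? Y v) ≤ # (atLeast? B′? Y′ v)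
  atLeast-≤ h v = go (suc (sumᶠ Y)) v (m≤n+m _ v)
    where
    open ≤-Reasoning
    go : ∀ d v → sumᶠ Y < v + d → 0 < v → # (atLeast? B? Y v) ≤ # (atLeast? B′? Y′ v)
    go zero    v b _ = ≤-trans (≤-reflexive (#-empty (atLeast? B? Y v) λ r (_ , p) →
      <⇒≱ (subst (sumᶠ Y <_) (+-identityʳ v) b) (≤-trans p (≤sumᶠ Y r)))) z≤n
    go (suc d) v b 0<v with Fin.any? (λ r → ¬? (B′? r) ×-dec (Y′ r ≟ v))
    ... | yes (r , ¬b , e) = h v r ¬b e 0<v
    ... | no none = begin
      # (atLeast? B? Y v)
        ≤⟨ #-cover _ (atLeast? B? Y (suc v)) (λ r → Y r ≟ v)
             (λ r (b , p) → [ (λ lt → inj₁ (b , lt)) , inj₂ ∘ sym ]′ (m≤n⇒m<n∨m≡n p)) ⟩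
      # (atLeast? B? Y (suc v)) + # (λ r → Y r ≟ v)
        ≤⟨ +-mono-≤ (go d (suc v) (subst (sumᶠ Y <_) (+-suc v d) b) z<s) (values 0<v inB′) ⟩
      # (atLeast? B′? Y′ (suc v)) + # (λ r → B′? r ×-dec (Y′ r ≟ v))
        ≤⟨ #-disjoint (atLeast? B′? Y′ v) _ _
             (λ r (b , p) → b , <⇒≤ p)
             (λ r (b , e) → b , ≤-reflexive (sym e))
             (λ r (_ , p) (_ , e) → <-irrefl (sym e) p) ⟩
      # (atLeast? B′? Y′ v) ∎
      where
      inB′ : ∀ r → Y′ r ≡ v → B′ r
      inB′ r e with B′? r
      ... | yes b = b
      ... | no ¬b = ⊥-elim (none (r , ¬b , e))

-- Grids

-- A grid records the entry in row r and column c + 1, and 0 where there is no box.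
Grid : ℕ → Set
Grid n = Fin n → ℕ → ℕ

col : ∀ {n} → Grid n → ℕ → Fin n → ℕ
col F c r = F r c

_∼_ : ∀ {n} → Grid n → Grid n → Set
F ∼ G = ∀ c → col F c ≈ᶜ col G c

∼-sym : ∀ {n} {F G : Grid n} → F ∼ G → G ∼ F
∼-sym e c = ≈ᶜ-sym (e c)

∼-trans : ∀ {n} {F G H : Grid n} → F ∼ G → G ∼ H → F ∼ H
∼-trans e e′ c = ≈ᶜ-trans (e c) (e′ c)

Antitone : (ℕ → ℕ) → Set
Antitone f = ∀ c → f (suc c) ≤ f c

antitone-≤ : ∀ {f} → Antitone f → ∀ {c d} → c ≤ d → f d ≤ f c
antitone-≤ {f} h {c} {d} c≤d = subst (λ e → f e ≤ f c) (m+[n∸m]≡n c≤d) (go (d ∸ c))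
  where
  go : ∀ k → f (c + k) ≤ f c
  go zero    = ≤-reflexive (cong f (+-identityʳ c))
  go (suc k) = ≤-trans (≤-reflexive (cong f (+-suc c k))) (≤-trans (h (c + k)) (go k))

Antitones : ∀ {n} → Grid n → Set
Antitones F = ∀ r → Antitone (F r)

-- In the pair relations f is the lower and g the upper of two rows.
DistinctPair : (f g : ℕ → ℕ) → Set
DistinctPair f g = ∀ c → 0 < g c → f c ≢ g c

-- Together with decreasing rows and an anchored first column, this stands for both types of
-- inversion triple without mentioning lengths: whenever the lower row could have taken the next
-- entry of the upper row, it took a larger one.
AtomPair : (f g : ℕ → ℕ) → Set
AtomPair f g = ∀ c → 0 < g (suc c) → g (suc c) ≤ f c → g (suc c) < f (suc c)

-- Since an absent box is 0, `descent` also asserts that the right neighbour exists. In `longer`,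
-- `ℓ` is a column reached by the upper row alone, which expresses that it is strictly longer.
record QuasiPair (f g : ℕ → ℕ) : Set where
  field
    distinct : DistinctPair f g
    descent  : ∀ c → 0 < g c → g c < f c → g c < f (suc c)
    longer   : ∀ ℓ → f ℓ ≡ 0 → 0 < g ℓ → ∀ c → 0 < f c → f c < g (suc c)

Pairwise : ∀ {n} {A : Set} → (A → A → Set) → (Fin n → A) → Set
Pairwise P F = ∀ r s → r Fin.< s → P (F r) (F s)

SameFirst : ∀ {n} → Grid n → Grid n → Set
SameFirst F G = ∀ r → F r 0 ≡ G r 0

-- Extremality and uniqueness of atom grids

prefix? : ∀ {n} j (r : Fin n) → Dec (toℕ r < j)
prefix? j r = toℕ r <? j

-- The prefixes of lengths `toℕ r` and `suc (toℕ r)` differ in row `r` alone.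
prefix-separate : ∀ {n} {P P′ : Fin n → Set} (P? : ∀ r → Dec (P r)) (P′? : ∀ r → Dec (P′ r)) →
  (∀ j → # (λ r → prefix? j r ×-dec P′? r) ≤ # (λ r → prefix? j r ×-dec P? r)) →
  (∀ j → # (λ r → prefix? j r ×-dec P? r) ≤ # (λ r → prefix? j r ×-dec P′? r)) →
  ∀ r → P r → P′ r
prefix-separate P? P′? le le′ r = separate (prefix? (toℕ r)) (prefix? (suc (toℕ r))) P? P′? r
  (λ _ → m<n⇒m<1+n)
  (λ s lt → [ inj₁ , inj₂ ∘ Fin.toℕ-injective ]′ (m≤n⇒m<n∨m≡n (s≤s⁻¹ lt)))
  (<-irrefl refl) ≤-refl (le (toℕ r)) (le′ (suc (toℕ r)))

module _ {n} {F G : Grid n} (F↓ : Antitones F) (G↓ : Antitones G)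
         (atom : Pairwise AtomPair G) (F∼G : F ∼ G) (F₀ : SameFirst F G) where

  -- Induction on the column. If `v` stands in column `suc c` of `G` in a row outside the prefix,
  -- every prefix row of `G` with an entry at least `v` in column `c` could have taken it, so by
  -- `AtomPair` its next entry exceeds `v`: the count for `G` does not drop, and that for `F` cannot
  -- grow.
  atom-dominates : ∀ c j v → 0 < v →
    # (atLeast? (prefix? j) (col F c) v) ≤ # (atLeast? (prefix? j) (col G c) v)
  atom-dominates zero    j v 0<v = #-mono _ _ λ r (lt , le) → lt , subst (v ≤_) (F₀ r) le
  atom-dominates (suc c) j = atLeast-≤ (prefix? j) (prefix? j) (F∼G (suc c)) λ { v s j≰s refl 0<v → begin
    # (atLeast? (prefix? j) (col F (suc c)) v)
      ≤⟨ #-mono _ _ (λ r (lt , le) → lt , ≤-trans le (F↓ r c)) ⟩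
    # (atLeast? (prefix? j) (col F c) v)
      ≤⟨ atom-dominates c j v 0<v ⟩
    # (atLeast? (prefix? j) (col G c) v)
      ≤⟨ #-mono _ _ (λ r (lt , le) → lt , <⇒≤ (atom r s (<-≤-trans lt (≮⇒≥ j≰s)) c 0<v le)) ⟩
    # (atLeast? (prefix? j) (col G (suc c)) v) ∎ }
    where open ≤-Reasoning

atom-unique : ∀ {n} {F G : Grid n} → Antitones F → Antitones G →
  Pairwise AtomPair F → Pairwise AtomPair G → F ∼ G → SameFirst F G → ∀ r c → F r c ≡ G r c
atom-unique {F = F} {G} F↓ G↓ F-atom G-atom F∼G F₀ r c = ≡-from-thresholds
  (λ v 0<v → prefix-separate (λ r → v ≤? F r c) (λ r → v ≤? G r c) (λ j → ≥ j v 0<v) (λ j → ≤′ j v 0<v) r)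
  (λ v 0<v → prefix-separate (λ r → v ≤? G r c) (λ r → v ≤? F r c) (λ j → ≤′ j v 0<v) (λ j → ≥ j v 0<v) r)
  where
  ≤′ = atom-dominates F↓ G↓ G-atom F∼G F₀ c
  ≥ = atom-dominates G↓ F↓ F-atom (∼-sym F∼G) (sym ∘ F₀) c

-- Comparison of the shapes of quasi-key and atom grids

module _ {n} {F G : Grid n} (F↓ : Antitones F) (G↓ : Antitones G)
         (quasi : Pairwise QuasiPair F) (F∼G : F ∼ G) where

  private
    alive? : ∀ (H : Grid n) ℓ r → Dec (0 < H r ℓ)
    alive? H ℓ r = 0 <? H r ℓ

  -- For `r` below `s`, a larger `F r c` would by `descent` give `F s c < F r (suc c)`; for `r`
  -- above `s`, `longer` gives that inequality outright.
  quasi-avoids : ∀ {ℓ r s c} → F s ℓ ≡ 0 → 0 < F r ℓ → 0 < F s c →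
                 F r (suc c) ≤ F s c → F r c ≤ F s c
  quasi-avoids {ℓ} {r} {s} {c} e p q le with Fin.<-cmp r s
  ... | tri< r<s _ _ = ≮⇒≥ λ lt → <⇒≱ (QuasiPair.descent (quasi r s r<s) c q lt) le
  ... | tri≈ _ refl _ = ≤-refl
  ... | tri> _ _ s<r = ⊥-elim (<⇒≱ (QuasiPair.longer (quasi s r s<r) ℓ e p c q) le)

  -- Induction from column `ℓ` leftwards, with `d` columns in between. Let `v` be an entry of `F` in
  -- a row with no box in column `ℓ`. Rows of `G` pass from column `c` to `suc c` without leaving
  -- the count, and `quasi-avoids` brings the rows of `F` back.
  quasi-dominates : ∀ {ℓ} d c → c + d ≡ ℓ → ∀ v →
    # (atMost? (alive? G ℓ) (col G c) v) ≤ # (atMost? (alive? F ℓ) (col F c) v)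
  quasi-dominates {ℓ} zero c refl = atMost-≤ (alive? G ℓ) (alive? F ℓ) (∼-sym F∼G c)
    -- In column `ℓ` itself every entry lies in a row counted by `alive?`.
    λ { v s ¬a refl 0<v → ⊥-elim (¬a (subst (λ d → 0 < F s d) (sym (+-identityʳ c)) 0<v)) }
  quasi-dominates {ℓ} (suc d) c eq = atMost-≤ (alive? G ℓ) (alive? F ℓ) (∼-sym F∼G c)
    λ { v s ¬a refl 0<v → begin
    # (atMost? (alive? G ℓ) (col G c) v)
      ≤⟨ #-mono _ _ (λ r (a , _ , le) → a , <-≤-trans a (antitone-≤ (G↓ r) c<ℓ) , ≤-trans (G↓ r c) le) ⟩
    # (atMost? (alive? G ℓ) (col G (suc c)) v)
      ≤⟨ quasi-dominates d (suc c) (trans (sym (+-suc c d)) eq) v ⟩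
    # (atMost? (alive? F ℓ) (col F (suc c)) v)
      ≤⟨ #-mono _ _ (λ r (a , p , le) → a , <-≤-trans p (F↓ r c) ,
           quasi-avoids (n≤0⇒n≡0 (≮⇒≥ ¬a)) a 0<v le) ⟩
    # (atMost? (alive? F ℓ) (col F c) v) ∎ }
    where
    open ≤-Reasoning
    c<ℓ : c < ℓ
    c<ℓ = subst (c <_) eq (subst (c <_) (sym (+-suc c d)) (s≤s (m≤m+n c d)))

Anchored : ∀ {n} → Grid n → Set
Anchored F = ∀ r → 0 < F r 0 → F r 0 ≡ suc (toℕ r)

module _ {n} {F G : Grid n} (F↓ : Antitones F) (G↓ : Antitones G)
         (quasi : Pairwise QuasiPair F) (atom : Pairwise AtomPair G)
         (F∼G : F ∼ G) (F₀ : SameFirst F G) (anchored : Anchored G) where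

  private
    alive≥ : ∀ ℓ j → # (λ r → prefix? j r ×-dec (0 <? F r ℓ)) ≤ # (λ r → prefix? j r ×-dec (0 <? G r ℓ))
    alive≥ ℓ j = atom-dominates F↓ G↓ atom F∼G F₀ ℓ j 1 z<s

    first : ∀ {H : Grid n} {r ℓ} → Antitones H → 0 < H r ℓ → 0 < H r 0
    first H↓ p = <-≤-trans p (antitone-≤ (H↓ _) z≤n)

    -- In an anchored first column, the rows with boxes and index less than `j` are those with first
    -- entry at most `j`, so `quasi-dominates` in column 0 compares prefixes.
    alive≤ : ∀ ℓ j → # (λ r → prefix? j r ×-dec (0 <? G r ℓ)) ≤ # (λ r → prefix? j r ×-dec (0 <? F r ℓ))
    alive≤ ℓ j = begin
      # (λ r → prefix? j r ×-dec (0 <? G r ℓ))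
        ≤⟨ #-mono _ _ (λ r (lt , p) → p , first {G} G↓ p ,
             subst (_≤ j) (sym (anchored r (first {G} G↓ p))) lt) ⟩
      # (atMost? (λ r → 0 <? G r ℓ) (col G 0) j)
        ≤⟨ quasi-dominates F↓ G↓ quasi F∼G ℓ 0 refl j ⟩
      # (atMost? (λ r → 0 <? F r ℓ) (col F 0) j)
        ≤⟨ #-mono _ _ (λ r (p , q , le) →
             subst (_≤ j) (trans (F₀ r) (anchored r (subst (0 <_) (F₀ r) q))) le , p) ⟩
      # (λ r → prefix? j r ×-dec (0 <? F r ℓ)) ∎
      where open ≤-Reasoning

  same-shape : ∀ r ℓ → (0 < F r ℓ → 0 < G r ℓ) × (0 < G r ℓ → 0 < F r ℓ)
  same-shape r ℓ =
    prefix-separate (λ r → 0 <? F r ℓ) (λ r → 0 <? G r ℓ) (alive≤ ℓ) (alive≥ ℓ) r ,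
    prefix-separate (λ r → 0 <? G r ℓ) (λ r → 0 <? F r ℓ) (alive≥ ℓ) (alive≤ ℓ) r

-- Uniqueness of quasi-key grids of given row lengths

HasLengths : ∀ {n} → (Fin n → ℕ) → Grid n → Set
HasLengths len F = ∀ r c → (c < len r → 0 < F r c) × (0 < F r c → c < len r)

-- Initial ℓ j is an initial segment of the rows ordered by decreasing length, ties upwards.
module _ {n} (len : Fin n → ℕ) where

  Initial : ℕ → ℕ → Fin n → Set
  Initial ℓ j r = ℓ < len r ⊎ (ℓ ≤ len r × toℕ r < j)

  initial? : ∀ ℓ j r → Dec (Initial ℓ j r)
  initial? ℓ j r = (ℓ <? len r) ⊎-dec ((ℓ ≤? len r) ×-dec (toℕ r <? j))

  module _ {F G : Grid n} (F↓ : Antitones F) (G↓ : Antitones G)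
           (quasi : Pairwise QuasiPair G) (F∼G : F ∼ G)
           (F-len : HasLengths len F) (G-len : HasLengths len G) where

    -- The strict form of `quasi-avoids`, with `distinct` excluding equality. If `r` lies above `s`,
    -- then `s`, being outside the segment, is strictly shorter, and `longer` applies at column
    -- `len s`, the first that `s` misses.
    initial-avoids : ∀ {ℓ j r s c} → Initial ℓ j r → ¬ Initial ℓ j s → 0 < G s c →
                     G r (suc c) ≤ G s c → G r c < G s c
    initial-avoids {ℓ} {j} {r} {s} {c} r∈ s∉ p le with Fin.<-cmp r s
    ... | tri< r<s _ _ = ≤∧≢⇒< (≮⇒≥ λ lt → <⇒≱ (QuasiPair.descent (quasi r s r<s) c p lt) le)
                               (QuasiPair.distinct (quasi r s r<s) c p)
    ... | tri≈ _ refl _ = ⊥-elim (s∉ r∈)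
    ... | tri> _ _ s<r = ⊥-elim (<⇒≱ (QuasiPair.longer (quasi s r s<r) (len s)
                           (n≤0⇒n≡0 (≮⇒≥ λ q → <-irrefl refl (proj₂ (G-len s (len s)) q)))
                           (proj₁ (G-len r (len s)) s-shorter) c p) le)
      where
      s-shorter : len s < len r
      s-shorter = case r∈ of λ
        { (inj₁ lt)         → ≤-<-trans (≮⇒≥ (s∉ ∘ inj₁)) lt
        ; (inj₂ (le , r<j)) → <-≤-trans (≰⇒> λ le′ → s∉ (inj₂ (le′ , <-trans s<r r<j))) le }

    -- As in `quasi-dominates`, from the right end `K`. The rows of the segment ending in column `c`
    -- are set apart: they are the same in both grids, and in `G` all their entries there lie below
    -- `v`, since the missing next entry is 0.
    initial-dominates : ∀ {K} → (∀ r → len r ≤ K) → ∀ ℓ j d c → K ≤ c + d → ∀ v →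
      # (atMost? (initial? ℓ j) (col F c) v) ≤ # (atMost? (initial? ℓ j) (col G c) v)
    initial-dominates bound ℓ j zero c K≤ v = #-mono _ _ λ r (_ , p , _) →
      ⊥-elim (<⇒≱ (proj₂ (F-len r c) p) (≤-trans (bound r) (subst (_ ≤_) (+-identityʳ c) K≤)))
    initial-dominates {K} bound ℓ j (suc d) c K≤ = atMost-≤ (initial? ℓ j) (initial? ℓ j) (F∼G c)
      λ { v s s∉ refl 0<v → begin
      # (atMost? (initial? ℓ j) (col F c) v)
        ≤⟨ #-cover _ (λ r → initial? ℓ j r ×-dec (len r ≟ suc c))
             (atMost? (initial? ℓ j) (col F (suc c)) v)
             (λ r (r∈ , p , le) → case m≤n⇒m<n∨m≡n (proj₂ (F-len r c) p) of λ
               { (inj₁ lt) → inj₂ (r∈ , proj₁ (F-len r (suc c)) lt , ≤-trans (F↓ r c) le)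
               ; (inj₂ eq) → inj₁ (r∈ , sym eq) }) ⟩
      # (λ r → initial? ℓ j r ×-dec (len r ≟ suc c)) + # (atMost? (initial? ℓ j) (col F (suc c)) v)
        ≤⟨ +-monoʳ-≤ _ (initial-dominates bound ℓ j d (suc c) (subst (K ≤_) (+-suc c d) K≤) v) ⟩
      # (λ r → initial? ℓ j r ×-dec (len r ≟ suc c)) + # (atMost? (initial? ℓ j) (col G (suc c)) v)
        ≤⟨ #-disjoint (atMost? (initial? ℓ j) (col G c) v) _ _
             (λ r (r∈ , eq) → r∈ , proj₁ (G-len r c) (≤-reflexive (sym eq)) ,
               <⇒≤ (initial-avoids r∈ s∉ 0<v (subst (_≤ v) (sym (ended eq)) z≤n)))
             (λ r (r∈ , p , le) → r∈ , <-≤-trans p (G↓ r c) , <⇒≤ (initial-avoids r∈ s∉ 0<v le))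
             (λ r (_ , eq) (_ , p , _) → n≮0 (subst (0 <_) (ended eq) p)) ⟩
      # (atMost? (initial? ℓ j) (col G c) v) ∎ }
      where
      open ≤-Reasoning
      ended : ∀ {r} → len r ≡ suc c → G r (suc c) ≡ 0
      ended {r} eq = n≤0⇒n≡0 (≮⇒≥ λ p → <-irrefl (sym eq) (proj₂ (G-len r (suc c)) p))

  module _ {F G : Grid n} (F↓ : Antitones F) (G↓ : Antitones G)
           (F-quasi : Pairwise QuasiPair F) (G-quasi : Pairwise QuasiPair G)
           (F∼G : F ∼ G) (F-len : HasLengths len F) (G-len : HasLengths len G) where

    quasi-≤ : ∀ r c → F r c ≤ G r c
    quasi-≤ r c with 0 <? G r c
    ... | no ¬p = ≤-trans (≮⇒≥ λ p → ¬p (proj₁ (G-len r c) (proj₂ (F-len r c) p))) z≤n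
    -- The segments just before and just after `r` joins differ in `r` alone; the threshold is the
    -- entry `G r c`.
    ... | yes p = proj₂ (separate (initial? ℓ (toℕ r)) (initial? ℓ (suc (toℕ r)))
      (λ s → (0 <? G s c) ×-dec (G s c ≤? v)) (λ s → (0 <? F s c) ×-dec (F s c ≤? v)) r
      (λ s → Sum.map₂ (map₂ m<n⇒m<1+n)) grow
      [ <-irrefl refl , <-irrefl refl ∘ proj₂ ]′ (inj₂ (≤-refl , ≤-refl))
      (initial-dominates F↓ G↓ G-quasi F∼G F-len G-len
        (≤sumᶠ len) ℓ (toℕ r) (sumᶠ len) c (m≤n+m _ c) v)
      (initial-dominates G↓ F↓ F-quasi (∼-sym F∼G) G-len F-len
        (≤sumᶠ len) ℓ (suc (toℕ r)) (sumᶠ len) c (m≤n+m _ c) v)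
      (p , ≤-refl))
      where
      ℓ = len r
      v = G r c
      grow : ∀ s → Initial ℓ (suc (toℕ r)) s → Initial ℓ (toℕ r) s ⊎ s ≡ r
      grow s (inj₁ lt) = inj₁ (inj₁ lt)
      grow s (inj₂ (le , lt)) with m≤n⇒m<n∨m≡n (s≤s⁻¹ lt)
      ... | inj₁ s<r = inj₁ (inj₂ (le , s<r))
      ... | inj₂ s≡r = inj₂ (Fin.toℕ-injective s≡r)

  quasi-unique : ∀ {F G : Grid n} → Antitones F → Antitones G →
    Pairwise QuasiPair F → Pairwise QuasiPair G → F ∼ G →
    HasLengths len F → HasLengths len G → ∀ r c → F r c ≡ G r c
  quasi-unique F↓ G↓ F-quasi G-quasi F∼G F-len G-len r c = ≤-antisym
    (quasi-≤ F↓ G↓ F-quasi G-quasi F∼G F-len G-len r c)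
    (quasi-≤ G↓ F↓ G-quasi F-quasi (∼-sym F∼G) G-len F-len r c)

-- Greedy arrangement of columns

≈ᶜ-permute : ∀ {n} (Y : Fin n → ℕ) (τ : Permutation′ n) → (λ i → Y (τ ⟨$⟩ʳ i)) ≈ᶜ Y
≈ᶜ-permute Y τ .sums f _ = sym (sum-permute (f ∘ Y) τ)

≈ᶜ-reflexive : ∀ {n} {Y Z : Fin n → ℕ} → (∀ r → Y r ≡ Z r) → Y ≈ᶜ Z
≈ᶜ-reflexive e .sums f _ = sum-cong-≗ (cong f ∘ e)

-- `x ⇝ y`: a row whose current entry is `x` may continue with `y`. `y ≼ z`: `z` is at least as
-- welcome as `y`.
module Greedy (_⇝_ : ℕ → ℕ → Set) (_⇝?_ : ∀ x y → Dec (x ⇝ y))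
              (_≼_ : ℕ → ℕ → Set) (≼-total : Total _≼_) (≼-trans : Transitive _≼_) where

  best : ∀ {n} {P : Fin n → Set} (P? : ∀ i → Dec (P i)) (Y : Fin n → ℕ) i → P i →
         ∃[ k ] P k × ∀ j → P j → Y j ≼ Y k
  best {suc n} P? Y i p with Fin.any? (P? ∘ suc)
  best {suc n} P? Y zero    p | no none = zero , p , λ
    { zero _ → [ id , id ]′ (≼-total _ _) ; (suc j) q → ⊥-elim (none (j , q)) }
  best {suc n} P? Y (suc i) p | no none = ⊥-elim (none (i , p))
  best {suc n} P? Y _ _ | yes (j , q) with best (P? ∘ suc) (Y ∘ suc) j q | P? zero
  ... | k , pk , max | no ¬p = suc k , pk , λ { zero p → ⊥-elim (¬p p) ; (suc j) → max j }
  ... | k , pk , max | yes p with ≼-total (Y zero) (Y (suc k))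
  ...   | inj₁ le = suc k , pk , λ { zero _ → le ; (suc j) → max j }
  ...   | inj₂ ge = zero , p , λ
    { zero _ → [ id , id ]′ (≼-total _ _) ; (suc j) q → ≼-trans (max j q) ge }

  -- The swap behind the greedy choice: row `i` takes `y′` from the later row `j`, and `j` can go on
  -- with the entry `y` given up by `i`.
  Exchangeable : ∀ {n} → (Fin n → ℕ) → Set
  Exchangeable X = ∀ {i j} → i Fin.< j → ∀ {y y′} → X i ⇝ y → X i ⇝ y′ → X j ⇝ y′ → y ≼ y′ → X j ⇝ y

  Compatible : ∀ {n} → (Fin n → ℕ) → (Fin n → ℕ) → Set
  Compatible X Y = ∀ i → X i ⇝ Y i

  Optimal : ∀ {n} → (Fin n → ℕ) → (Fin n → ℕ) → Set
  Optimal X Y = ∀ i j → i Fin.< j → X i ⇝ Y j → Y j ≼ Y i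

  -- Row `zero` takes the best entry open to it; `transpose zero k` gives its own entry to the
  -- previous owner, which `Exchangeable` allows, and the remaining rows recurse.
  pick : ∀ {n} (X Y : Fin n → ℕ) → Exchangeable X → Compatible X Y →
         ∃[ σ ] Compatible X (λ i → Y (σ ⟨$⟩ʳ i)) × Optimal X (λ i → Y (σ ⟨$⟩ʳ i))
  pick {zero}  X Y ex link = Perm.id , (λ ()) , λ ()
  pick {suc n} X Y ex link with best (λ j → X zero ⇝? Y j) Y zero (link zero)
  ... | k , X₀⇝Yₖ , max with pick (X ∘ suc) (λ i → Y (transpose zero k ⟨$⟩ʳ suc i)) (ex ∘ s≤s) link′
    where
    link′ : ∀ i → X (suc i) ⇝ Y (transpose zero k ⟨$⟩ʳ suc i)
    link′ i with suc i Fin.≟ k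
    ... | yes refl = ex z<s (link zero) X₀⇝Yₖ (link k) (max zero (link zero))
    ... | no _     = link (suc i)
  ... | σ , links , opt = lift₀ σ ∘ₚ transpose zero k
    , (λ { zero → X₀⇝Yₖ ; (suc i) → links i })
    , λ { zero    (suc j) _        r → max (transpose zero k ⟨$⟩ʳ suc (σ ⟨$⟩ʳ j)) r
        ; (suc i) (suc j) (s≤s lt) r → opt i j lt r }

  -- `Inv` is the property of the current column on which exchangeability rests.
  module Run {n} (R : Grid n) (links : ∀ c → Compatible (col R c) (col R (suc c)))
           (Inv : (Fin n → ℕ) → Set) (exchange : ∀ X → Inv X → Exchangeable X)
           (inv₀ : Inv (col R 0))
           (preserve : ∀ X Y → Inv X → Compatible X Y → Optimal X Y → Inv Y) where

    private
      step : ∀ c (τ : Permutation′ n) → Inv (λ i → R (τ ⟨$⟩ʳ i) c) → ∃[ σ ]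
        Compatible (λ i → R (τ ⟨$⟩ʳ i) c) (λ i → R (τ ⟨$⟩ʳ (σ ⟨$⟩ʳ i)) (suc c)) ×
        Optimal (λ i → R (τ ⟨$⟩ʳ i) c) (λ i → R (τ ⟨$⟩ʳ (σ ⟨$⟩ʳ i)) (suc c))
      -- Column `suc c` is first carried along by the permutation already applied to column `c`, so
      -- `links` supplies a compatible start.
      step c τ inv = pick _ (λ i → R (τ ⟨$⟩ʳ i) (suc c)) (exchange _ inv) (λ i → links c (τ ⟨$⟩ʳ i))

      state : ∀ c → ∃[ τ ] Inv (λ i → R (τ ⟨$⟩ʳ i) c)
      state zero    = Perm.id , inv₀
      state (suc c) =
        let τ , inv = state c
            σ , link , opt = step c τ inv
        in σ ∘ₚ τ , preserve _ _ inv link opt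

    placement : ℕ → Permutation′ n
    placement c = proj₁ (state c)

    arranged : Grid n
    arranged i c = R (placement c ⟨$⟩ʳ i) c

    arranged-links : ∀ c → Compatible (col arranged c) (col arranged (suc c))
    arranged-links c = proj₁ (proj₂ (step c (placement c) (proj₂ (state c))))

    arranged-optimal : ∀ c → Optimal (col arranged c) (col arranged (suc c))
    arranged-optimal c = proj₂ (proj₂ (step c (placement c) (proj₂ (state c))))

    arranged-inv : ∀ c → Inv (col arranged c)
    arranged-inv c = proj₂ (state c)

-- Existence of atom and quasi-key arrangements

Distinct : ∀ {n} → Grid n → Set
Distinct F = ∀ c r s → 0 < F r c → F r c ≡ F s c → r ≡ s

module _ {n} {R : Grid n} (τ : ℕ → Permutation′ n) (R-distinct : Distinct R) where

  permuted-distinct : Distinct (λ i c → R (τ c ⟨$⟩ʳ i) c)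
  permuted-distinct c r s p e =
    trans (sym (Perm.inverseˡ (τ c)))
      (trans (cong (τ c ⟨$⟩ˡ_) (R-distinct c _ _ p e)) (Perm.inverseˡ (τ c)))

opaque

  -- Whatever is smaller than an acceptable entry is acceptable, so an exchange always succeeds.
  -- Optimality and distinctness give the strict inequality of `AtomPair`, and the run starts from
  -- the identity, which keeps the first column.
  atom-exists : ∀ {n} {F : Grid n} → Antitones F → Distinct F →
    ∃[ G ] Antitones G × Distinct G × Pairwise AtomPair G × F ∼ G × SameFirst F G
  atom-exists {n} {F} F↓ F-distinct = G , (λ r c → arranged-links c r) , G-distinct , G-atom
    , (λ c → ≈ᶜ-sym (≈ᶜ-permute (col F c) (placement c))) , (λ _ → refl)
    where
    open Greedy _≥_ _≥?_ _≤_ ≤-total ≤-trans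
    open Run F (λ c r → F↓ r c) (λ _ → ⊤) (λ _ _ _ _ _ le le′ → ≤-trans le′ le) tt (λ _ _ _ _ _ → tt)
      renaming (arranged to G)
    G-distinct : Distinct G
    G-distinct = permuted-distinct placement F-distinct
    G-atom : Pairwise AtomPair G
    G-atom r s r<s c p le = ≤∧≢⇒< (arranged-optimal c r s r<s le)
      λ e → Fin.<⇒≢ r<s (sym (G-distinct (suc c) s r p e))

-- Preferring small entries, with an absent box as the last resort.
_≼_ : ℕ → ℕ → Set
y ≼ z = y ≡ 0 ⊎ (0 < z × z ≤ y)

≼-total : Total _≼_
≼-total zero    z       = inj₁ (inj₁ refl)
≼-total (suc y) zero    = inj₂ (inj₁ refl)
≼-total (suc y) (suc z) =
  Sum.map (λ le → inj₂ (z<s , le)) (λ le → inj₂ (z<s , le)) (≤-total (suc z) (suc y))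

≼-trans : Transitive _≼_
≼-trans (inj₁ e)        _                 = inj₁ e
≼-trans (inj₂ (p , le)) (inj₁ refl)       = ⊥-elim (n≮0 p)
≼-trans (inj₂ (p , le)) (inj₂ (q , le′))  = inj₂ (q , ≤-trans le′ le)

-- Columns are filled from right to left here, so the greedy run sees column K ∸ d at time d.
module _ {n} {S : Grid n} {K} (S↓ : Antitones S) (S-distinct : Distinct S)
         (S-end : ∀ r → S r K ≡ 0) where

  private
    R : Grid n
    R r d = S r (K ∸ d)

    -- A row giving up an absent box in an exchange has no current entry; by this invariant neither
    -- has the later row, which therefore accepts the absent box.
    AliveFirst : (Fin n → ℕ) → Set
    AliveFirst X = ∀ i j → i Fin.< j → 0 < X j → 0 < X i

    open Greedy _≤_ _≤?_ _≼_ ≼-total ≼-trans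

    exchange : ∀ X → AliveFirst X → Exchangeable X
    exchange X inv {i} {j} i<j le le′ le″ (inj₁ refl)     = ≮⇒≥ λ p → <⇒≱ (inv i j i<j p) le
    exchange X inv {i} {j} i<j le le′ le″ (inj₂ (p , ge)) = ≤-trans le″ ge

    preserve : ∀ X Y → AliveFirst X → Compatible X Y → Optimal X Y → AliveFirst Y
    preserve X Y inv link opt i j i<j p with X i ≤? 0
    ... | no  ¬z = <-≤-trans (≰⇒> ¬z) (link i)
    ... | yes z  with opt i j i<j (≤-trans z z≤n)
    ...   | inj₁ e       = ⊥-elim (n≮0 (subst (0 <_) e p))
    ...   | inj₂ (q , _) = q

    -- The run starts from column `K`, which is empty, so the invariant holds vacuously.
    open Run R (λ d r → antitone-≤ (S↓ r) (∸-monoʳ-≤ K (n≤1+n d))) AliveFirst exchange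
      (λ i j _ p → ⊥-elim (n≮0 (subst (0 <_) (S-end j) p))) preserve

    -- Time is turned back into columns; the rows stand in the order in which they were served.
    P : Grid n
    P i c = arranged i (K ∸ c)

    P-first : ∀ {i j} → i Fin.< j → ∀ c → 0 < P j c → 0 < P i c
    P-first i<j c = arranged-inv (K ∸ c) _ _ i<j

    beyond : ∀ i {c} → K ≤ c → P i c ≡ 0
    beyond i {c} K≤c = trans (cong (arranged i) (m≤n⇒m∸n≡0 K≤c)) (S-end _)

    P∼S : P ∼ S
    P∼S c with c ≤? K
    ... | yes c≤K = subst (λ d → col P c ≈ᶜ col S d) (m∸[m∸n]≡n c≤K)
      (≈ᶜ-permute (col S (K ∸ (K ∸ c))) (placement (K ∸ c)))
    ... | no  c≰K = ≈ᶜ-reflexive λ r → trans (beyond r K≤c)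
      (sym (n≤0⇒n≡0 (≤-trans (antitone-≤ (S↓ r) K≤c) (≤-reflexive (S-end r)))))
      where
      K≤c : K ≤ c
      K≤c = <⇒≤ (≰⇒> c≰K)

    P-distinct : Distinct P
    P-distinct c r s p e = permuted-distinct {R = R} placement (λ d → S-distinct (K ∸ d)) (K ∸ c) r s p e

    suc-mirror : ∀ {c} → c < K → suc (K ∸ suc c) ≡ K ∸ c
    suc-mirror c<K = sym (+-∸-assoc 1 c<K)

    P↓ : Antitones P
    P↓ i c with c <? K
    ... | yes c<K = subst (λ d → P i (suc c) ≤ arranged i d) (suc-mirror c<K)
      (arranged-links (K ∸ suc c) i)
    ... | no  c≮K = ≤-reflexive (trans (beyond i (m≤n⇒m≤1+n (≮⇒≥ c≮K))) (sym (beyond i (≮⇒≥ c≮K))))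

    -- Were `P i (suc c) ≤ P j c`, row `i`, served first, could have taken `P j c` and would hold an
    -- entry at most that.
    P-greedy : ∀ {i j} → i Fin.< j → ∀ c → 0 < P j c → P j c < P i c → P j c < P i (suc c)
    P-greedy {i} {j} i<j c p lt with c <? K
    ... | no  c≮K = ⊥-elim (n≮0 (subst (0 <_) (beyond j (≮⇒≥ c≮K)) p))
    ... | yes c<K = ≰⇒> λ le →
      case subst (λ d → P i (suc c) ≤ arranged j d → arranged j d ≼ arranged i d) (suc-mirror c<K)
             (arranged-optimal (K ∸ suc c) i j i<j) le of λ
      { (inj₁ e) → n≮0 (subst (0 <_) e p) ; (inj₂ (_ , ge)) → <⇒≱ lt ge }

  opaque

    quasi-exists : Pairwise (λ f g → 0 < f 0 → 0 < g 0 → f 0 < g 0) S →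
      ∃[ T ] Antitones T × Pairwise QuasiPair T × T ∼ S × SameFirst T S
    quasi-exists increasing = T , (λ r → P↓ (ρ r)) , T-quasi
      , (λ c → ≈ᶜ-trans (≈ᶜ-permute (col P c) (Perm.flip (placement K))) (P∼S c)) , T₀
      where
      -- The row of `P` that receives in column 0 the first entry of row `r` of `S`.
      ρ : Fin n → Fin n
      ρ r = placement K ⟨$⟩ˡ r
      T : Grid n
      T r = P (ρ r)
      T₀ : SameFirst T S
      T₀ r = cong₂ S (Perm.inverseʳ (placement K)) (n∸n≡0 K)
      T-increasing : ∀ r s → r Fin.< s → 0 < T r 0 → 0 < T s 0 → T r 0 < T s 0
      T-increasing r s r<s p q = subst₂ _<_ (sym (T₀ r)) (sym (T₀ s))
        (increasing r s r<s (subst (0 <_) (T₀ r) p) (subst (0 <_) (T₀ s) q))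

      T-distinct : Distinct T
      T-distinct c r s p e = trans (sym (Perm.inverseʳ (placement K)))
        (trans (cong (placement K ⟨$⟩ʳ_) (P-distinct c (ρ r) (ρ s) p e)) (Perm.inverseʳ (placement K)))

      T-quasi : Pairwise QuasiPair T
      T-quasi r s r<s = record
        { distinct = λ c p e → Fin.<⇒≢ r<s (sym (T-distinct c s r p (sym e)))
        ; descent  = descent
        ; longer   = longer
        }
        where
        -- If the upper row is served first, it starts larger and stays larger, one column ahead
        -- too: this yields `longer` and leaves no case for `descent`. If the lower row is served
        -- first, `P-greedy` is `descent`, and `P-first` excludes a longer upper row.
        below : ρ s Fin.< ρ r → ∀ c → 0 < T r c → T r c < T s c × T r c < T s (suc c)
        below s≺r zero    p = lt , P-greedy s≺r 0 p lt
          where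
          lt : T r 0 < T s 0
          lt = T-increasing r s r<s p (P-first s≺r 0 p)
        below s≺r (suc c) p = lt , P-greedy s≺r (suc c) p lt
          where
          lt : T r (suc c) < T s (suc c)
          lt = ≤-<-trans (P↓ (ρ r) c) (proj₂ (below s≺r c (<-≤-trans p (P↓ (ρ r) c))))

        ρ-apart : ρ r ≢ ρ s
        ρ-apart e = Fin.<⇒≢ r<s (trans (sym (Perm.inverseʳ (placement K)))
          (trans (cong (placement K ⟨$⟩ʳ_) e) (Perm.inverseʳ (placement K))))

        descent : ∀ c → 0 < T s c → T s c < T r c → T s c < T r (suc c)
        descent c p lt with Fin.<-cmp (ρ r) (ρ s)
        ... | tri< r≺s _ _ = P-greedy r≺s c p lt
        ... | tri≈ _ e _   = ⊥-elim (ρ-apart e)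
        ... | tri> _ _ s≺r = ⊥-elim (<-asym lt (proj₁ (below s≺r c (<-trans p lt))))

        longer : ∀ ℓ → T r ℓ ≡ 0 → 0 < T s ℓ → ∀ c → 0 < T r c → T r c < T s (suc c)
        longer ℓ e p c q with Fin.<-cmp (ρ r) (ρ s)
        ... | tri< r≺s _ _ = ⊥-elim (n≮0 (subst (0 <_) e (P-first r≺s ℓ p)))
        ... | tri≈ _ e _   = ⊥-elim (ρ-apart e)
        ... | tri> _ _ s≺r = proj₂ (below s≺r c q)

-- Fillings as grids

at : List ℕ → ℕ → ℕ
at []       _       = 0
at (x ∷ _)  zero    = x
at (_ ∷ xs) (suc c) = at xs c

entry⇒at : ∀ xs c {k} → entry xs c ≡ just k → at xs c ≡ k
entry⇒at []       zero    ()
entry⇒at []       (suc c) ()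
entry⇒at (x ∷ xs) zero    e = just-injective e
entry⇒at (x ∷ xs) (suc c) e = entry⇒at xs c e

at⇒entry : ∀ xs c → 0 < at xs c → entry xs c ≡ just (at xs c)
at⇒entry []       c       p = ⊥-elim (n≮0 p)
at⇒entry (x ∷ xs) zero    p = refl
at⇒entry (x ∷ xs) (suc c) p = at⇒entry xs c p

Positive : List ℕ → Set
Positive = All (0 <_)

at-alive : ∀ {xs} → Positive xs → ∀ c →
  (c < List.length xs → 0 < at xs c) × (0 < at xs c → c < List.length xs)
at-alive []       c       = (λ ()) , (λ ())
at-alive (p ∷ ps) zero    = (λ _ → p) , (λ _ → z<s)
at-alive (p ∷ ps) (suc c) = let f , g = at-alive ps c in f ∘ s≤s⁻¹ , s≤s ∘ g

entry-positive : ∀ {xs c k} → Positive xs → entry xs c ≡ just k → 0 < k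
entry-positive {c = zero}  (p ∷ ps) refl = p
entry-positive {c = suc c} (p ∷ ps) e    = entry-positive {c = c} ps e
entry-positive {c = suc c} []       ()

at-length : ∀ xs → at xs (List.length xs) ≡ 0
at-length []       = refl
at-length (_ ∷ xs) = at-length xs

at-antitone : ∀ {xs} → Linked _≥_ xs → Antitone (at xs)
at-antitone []      c       = z≤n
at-antitone [-]     c       = z≤n
at-antitone (p ∷ l) zero    = p
at-antitone (p ∷ l) (suc c) = at-antitone l c

antitone-linked : ∀ xs → Antitone (at xs) → Linked _≥_ xs
antitone-linked []           h = []
antitone-linked (x ∷ [])     h = [-]
antitone-linked (x ∷ y ∷ xs) h = h 0 ∷ antitone-linked (y ∷ xs) (h ∘ suc)

same-length : ∀ {xs ys} → Positive xs → Positive ys →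
  (∀ c → (0 < at xs c → 0 < at ys c) × (0 < at ys c → 0 < at xs c)) → List.length xs ≡ List.length ys
same-length []       []       h = refl
same-length []       (q ∷ qs) h = ⊥-elim (n≮0 (proj₂ (h 0) q))
same-length (p ∷ ps) []       h = ⊥-elim (n≮0 (proj₁ (h 0) p))
same-length (p ∷ ps) (q ∷ qs) h = cong suc (same-length ps qs (h ∘ suc))

at-injective : ∀ {xs ys} → Positive xs → Positive ys → (∀ c → at xs c ≡ at ys c) → xs ≡ ys
at-injective []       []       h = refl
at-injective []       (q ∷ qs) h = ⊥-elim (<⇒≢ q (h 0))
at-injective (p ∷ ps) []       h = ⊥-elim (<⇒≢ p (sym (h 0)))
at-injective (p ∷ ps) (q ∷ qs) h = cong₂ _∷_ (h 0) (at-injective ps qs (h ∘ suc))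

support : ℕ → (ℕ → ℕ) → List ℕ
support zero    f = []
support (suc K) f with f 0
... | zero  = []
... | suc x = suc x ∷ support K (f ∘ suc)

support-positive : ∀ K f → Positive (support K f)
support-positive zero    f = []
support-positive (suc K) f with f 0
... | zero  = []
... | suc x = z<s ∷ support-positive K (f ∘ suc)

antitone-zero : ∀ {f} → Antitone f → ∀ {c d} → c ≤ d → f c ≡ 0 → f d ≡ 0
antitone-zero h c≤d e = n≤0⇒n≡0 (≤-trans (antitone-≤ h c≤d) (≤-reflexive e))

at-support : ∀ {f} → Antitone f → ∀ K → f K ≡ 0 → ∀ c → at (support K f) c ≡ f c
at-support         h zero    e c       = sym (antitone-zero h z≤n e)
at-support {f}     h (suc K) e c       with f 0 in eq
at-support         h (suc K) e c       | zero  = sym (antitone-zero h z≤n eq)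
at-support         h (suc K) e zero    | suc x = sym eq
at-support {f}     h (suc K) e (suc c) | suc x = at-support (h ∘ suc) K e c

grid : ∀ {n} → Filling n → Grid n
grid T r = at (lookup T r)

record Regular {n} (T : Filling n) : Set where
  field
    positive : ∀ r → Positive (lookup T r)
    linked   : ∀ r → Linked _≥_ (lookup T r)

  antitones : Antitones (grid T)
  antitones r = at-antitone (linked r)

open Regular

lengths : ∀ {n} → Filling n → Vec ℕ n
lengths = Vec.map List.length

FirstPair : (f g : ℕ → ℕ) → Set
FirstPair f g = 0 < f 0 → 0 < g 0 → f 0 < g 0

record IsQuasi {n} (T : Filling n) : Set where
  field
    regular : Regular T
    quasi   : Pairwise QuasiPair (grid T)
    first   : Pairwise FirstPair (grid T)
    bounded : ∀ r → grid T r 0 ≤ label r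

record IsAtom {n} (S : Filling n) : Set where
  field
    regular  : Regular S
    distinct : Distinct (grid S)
    atom     : Pairwise AtomPair (grid S)
    anchored : Anchored (grid S)

-- From `g d ≤ f d` follows `g (suc d) ≤ f d`, so `AtomPair` applies in each further column.
atom-stays : ∀ {f g} → AtomPair f g → Antitone g → ∀ {c d} → c < d → g (suc c) ≤ f (suc c) → g d ≤ f d
atom-stays {f} {g} h g↓ {c} {suc d} c<d le with m≤n⇒m<n∨m≡n c<d
... | inj₂ refl = le
... | inj₁ (s≤s c<d′) with g (suc d) in eq
...   | zero  = z≤n
...   | suc x = ≤-trans (≤-reflexive (sym eq)) (<⇒≤ (h d (subst (0 <_) (sym eq) z<s)
                  (≤-trans (g↓ d) (atom-stays h g↓ c<d′ le))))

distinctPair⇒distinct : ∀ {n} {F : Grid n} → Pairwise DistinctPair F → Distinct F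
distinctPair⇒distinct h c r s p e with Fin.<-cmp r s
... | tri< r<s _ _ = ⊥-elim (h r s r<s c (subst (0 <_) e p) e)
... | tri≈ _ r≡s _ = r≡s
... | tri> _ _ s<r = ⊥-elim (h s r s<r c p (sym e))

-- Translation of the defining conditions

module _ {n} {a : WeakComposition n} {T : Filling n} where

  isFilling⇒regular : IsFilling a T → RowsDecrease T → Regular T
  isFilling⇒regular f d = record
    { positive = VecAll.lookup⁺ (IsFilling.positive f) ; linked = VecAll.lookup⁺ d }

  lookup-shape : IsFilling a T → ∀ r → lookup a r ≡ List.length (lookup T r)
  lookup-shape f r = trans (cong (λ b → lookup b r) (sym (IsFilling.shape f)))
    (Vec.lookup-map r List.length T)

  regular⇒isFilling : Regular T → lengths T ≡ a → IsFilling a T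
  regular⇒isFilling reg e = record { shape = e ; positive = VecAll.lookup⁻ (positive reg) }

  columnsDistinct⇒ : ColumnsDistinct T → Pairwise DistinctPair (grid T)
  columnsDistinct⇒ d r s r<s c p e = d r s r<s c _
    (at⇒entry (lookup T r) c (subst (0 <_) (sym e) p)) _ (at⇒entry (lookup T s) c p) e

  ⇒columnsDistinct : Regular T → Pairwise DistinctPair (grid T) → ColumnsDistinct T
  ⇒columnsDistinct reg d r s r<s c k p l q e = d r s r<s c
    (subst (0 <_) (sym (entry⇒at (lookup T s) c q)) (entry-positive {c = c} (positive reg s) q))
    (trans (entry⇒at (lookup T r) c p) (trans e (sym (entry⇒at (lookup T s) c q))))

  isQuasiKey⇒isQuasi : IsQuasiKey a T → IsQuasi T
  isQuasiKey⇒isQuasi q = record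
    { regular = reg
    ; quasi = λ r s r<s → record
      { distinct = columnsDistinct⇒ columnsDistinct r s r<s
      ; descent = λ c p lt →
          let j , e , i<j = descent r s r<s c _ (en r c (<-trans p lt)) _ (en s c p) lt in
          subst (grid T s c <_) (sym (entry⇒at (lookup T r) (suc c) e)) i<j
      ; longer = λ ℓ e p c q → longerAbove r s r<s (shorter r s ℓ e p) c _ (en r c q) _
          -- The lower row has a box at `c` and is shorter, so the upper row has one at `suc c`.
          (en s (suc c) (alive s (suc c) (≤-<-trans (alive′ r c q) (shorter′ r s ℓ e p))))
      }
    ; first = λ r s r<s p q → firstColumnIncreases r s r<s _ (en r 0 p) _ (en s 0 q)
    ; bounded = λ r → bound r (lookup T r) (rowsBounded r)
    }
    where
    open IsQuasiKey q
    reg = isFilling⇒regular isFilling rowsDecrease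
    en : ∀ r c → 0 < grid T r c → entry (lookup T r) c ≡ just (grid T r c)
    en r c = at⇒entry (lookup T r) c
    alive : ∀ r c → c < List.length (lookup T r) → 0 < grid T r c
    alive r c = proj₁ (at-alive (positive reg r) c)
    alive′ : ∀ r c → 0 < grid T r c → c < List.length (lookup T r)
    alive′ r c = proj₂ (at-alive (positive reg r) c)
    shorter′ : ∀ r s ℓ → grid T r ℓ ≡ 0 → 0 < grid T s ℓ →
      List.length (lookup T r) < List.length (lookup T s)
    shorter′ r s ℓ e p = ≤-<-trans (≮⇒≥ λ lt → <⇒≢ (alive r ℓ lt) (sym e)) (alive′ s ℓ p)
    shorter : ∀ r s ℓ → grid T r ℓ ≡ 0 → 0 < grid T s ℓ → lookup a r < lookup a s
    shorter r s ℓ e p = subst₂ _<_ (sym (lookup-shape isFilling r))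
      (sym (lookup-shape isFilling s)) (shorter′ r s ℓ e p)
    bound : ∀ r xs → All (_≤ label r) xs → at xs 0 ≤ label r
    bound r []       _       = z≤n
    bound r (x ∷ xs) (p ∷ _) = p

  isQuasi⇒isQuasiKey : IsQuasi T → lengths T ≡ a → IsQuasiKey a T
  isQuasi⇒isQuasiKey q shape = record
    { isFilling = fil
    ; rowsDecrease = VecAll.lookup⁻ (linked regular)
    ; rowsBounded = λ r → bound (linked regular r) (bounded r)
    ; columnsDistinct = ⇒columnsDistinct regular (λ r s r<s → QuasiPair.distinct (quasi r s r<s))
    ; firstColumnIncreases = λ r s r<s k p l q → subst₂ _<_ (va r 0 p) (va s 0 q)
        (first r s r<s (pos r 0 p) (pos s 0 q))
    ; descent = λ r s r<s c k p i q i<k →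
        let lt = QuasiPair.descent (quasi r s r<s) c (pos s c q)
                   (subst₂ _<_ (sym (va s c q)) (sym (va r c p)) i<k) in
        _ , at⇒entry (lookup T r) (suc c) (≤-<-trans z≤n lt) , subst (_< _) (va s c q) lt
    ; longerAbove = λ r s r<s lt c i p j q → subst₂ _<_ (va r c p) (va s (suc c) q)
        (QuasiPair.longer (quasi r s r<s) (List.length (lookup T r)) (at-length (lookup T r))
          (proj₁ (at-alive (positive regular s) _)
            (subst₂ _<_ (lookup-shape fil r) (lookup-shape fil s) lt))
          c (pos r c p))
    }
    where
    open IsQuasi q
    fil = regular⇒isFilling regular shape
    va : ∀ r c {k} → entry (lookup T r) c ≡ just k → grid T r c ≡ k
    va r c = entry⇒at (lookup T r) c
    pos : ∀ r c {k} → entry (lookup T r) c ≡ just k → 0 < grid T r c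
    pos r c e = subst (0 <_) (sym (va r c e)) (entry-positive {c = c} (positive regular r) e)
    bound : ∀ {m xs} → Linked _≥_ xs → at xs 0 ≤ m → All (_≤ m) xs
    bound []      _ = []
    bound [-]     h = h ∷ []
    bound (p ∷ l) h = h ∷ bound l (≤-trans p h)

  isAtomFilling⇒isAtom : IsAtomFilling a T → IsAtom T
  isAtomFilling⇒isAtom t = record
    { regular = reg
    ; distinct = distinctPair⇒distinct (columnsDistinct⇒ columnsDistinct)
    ; atom = λ r s r<s → pair r s r<s
    ; anchored = anch
    }
    where
    open IsAtomFilling t
    reg = isFilling⇒regular isFilling rowsDecrease
    ↓ = antitones reg
    en : ∀ r c → 0 < grid T r c → entry (lookup T r) c ≡ just (grid T r c)
    en r c = at⇒entry (lookup T r) c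
    len : ∀ r → lookup a r ≡ List.length (lookup T r)
    len = lookup-shape isFilling
    alive : ∀ r c → c < lookup a r → 0 < grid T r c
    alive r c lt = proj₁ (at-alive (positive reg r) c) (subst (c <_) (len r) lt)
    alive′ : ∀ r c → 0 < grid T r c → c < lookup a r
    alive′ r c p = subst (c <_) (sym (len r)) (proj₂ (at-alive (positive reg r) c) p)
    anch : Anchored (grid T)
    anch r p = firstColumn r _ (en r 0 p)
    pair : ∀ r s → r Fin.< s → AtomPair (grid T r) (grid T s)
    pair r s r<s c p le with lookup a s ≤? lookup a r
    ... | yes shorter with typeA r s r<s shorter c _ (en r c (<-≤-trans p le)) _
          (en r (suc c) (alive r (suc c) (<-≤-trans (alive′ s (suc c) p) shorter))) _ (en s (suc c) p)
    ...   | inj₁ (lt , _) = ⊥-elim (<⇒≱ lt le)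
    ...   | inj₂ (_ , lt) = lt
    -- Here the type B triples show, starting from the anchored first column, that each lower entry
    -- stays below the upper entry of its column and of the next one, so `le` is impossible.
    pair r s r<s c p le | no ¬shorter = ⊥-elim (<⇒≱ (proj₂ (below c (<-≤-trans p le))) le)
      where
      longer : lookup a r < lookup a s
      longer = ≰⇒> ¬shorter
      next : ∀ c → 0 < grid T r c → grid T r c < grid T s c → grid T r c < grid T s (suc c)
      next c q lt with typeB r s r<s longer c _ (en s c (<-trans q lt)) _
        (en s (suc c) (alive s (suc c) (≤-<-trans (alive′ r c q) longer))) _ (en r c q)
      ... | inj₁ (lt′ , _) = ⊥-elim (<-asym lt lt′)
      ... | inj₂ (_ , lt′) = lt′
      below : ∀ c → 0 < grid T r c → grid T r c < grid T s c × grid T r c < grid T s (suc c)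
      below zero q = lt , next 0 q lt
        where
        lt : grid T r 0 < grid T s 0
        lt = subst₂ _<_ (sym (anch r q))
          (sym (anch s (alive s 0 (<-trans (alive′ r 0 q) longer)))) (s≤s r<s)
      below (suc c) q = lt , next (suc c) q lt
        where
        lt : grid T r (suc c) < grid T s (suc c)
        lt = ≤-<-trans (↓ r c) (proj₂ (below c (<-≤-trans q (↓ r c))))

  isAtom⇒isAtomFilling : IsAtom T → lengths T ≡ a → IsAtomFilling a T
  isAtom⇒isAtomFilling t shape = record
    { isFilling = fil
    ; rowsDecrease = VecAll.lookup⁻ (linked regular)
    ; columnsDistinct = ⇒columnsDistinct regular λ r s r<s c p e →
        Fin.<⇒≢ r<s (distinct c r s (subst (0 <_) (sym e) p) e)
    ; typeA = λ r s r<s _ c γ p α q β u → subst₂ (λ (α , β) γ → Inversion α β γ)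
        (cong₂ _,_ (va r (suc c) q) (va s (suc c) u)) (va r c p)
        (inversionA r s r<s c (pos s (suc c) u))
    ; typeB = λ r s r<s lt c γ p α q β u → subst₂ (λ (α , β) γ → Inversion α β γ)
        (cong₂ _,_ (va s (suc c) q) (va r c u)) (va s c p)
        (inversionB r s r<s (subst₂ _<_ (lookup-shape fil r) (lookup-shape fil s) lt) c
          (pos s (suc c) q))
    ; firstColumn = λ r k p → trans (sym (va r 0 p)) (anchored r (pos r 0 p))
    }
    where
    open IsAtom t
    fil = regular⇒isFilling regular shape
    ↓ = antitones regular
    va : ∀ r c {k} → entry (lookup T r) c ≡ just k → grid T r c ≡ k
    va r c = entry⇒at (lookup T r) c
    pos : ∀ r c {k} → entry (lookup T r) c ≡ just k → 0 < grid T r c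
    pos r c e = subst (0 <_) (sym (va r c e)) (entry-positive {c = c} (positive regular r) e)
    inversionA : ∀ r s → r Fin.< s → ∀ c → 0 < grid T s (suc c) →
      Inversion (grid T r (suc c)) (grid T s (suc c)) (grid T r c)
    inversionA r s r<s c p with grid T s (suc c) ≤? grid T r c
    ... | yes le = inj₂ (↓ r c , atom r s r<s c p le)
    ... | no ¬le = inj₁ (≰⇒> ¬le , ↓ r c)
    -- Once the upper row falls below the lower one it stays there, so it cannot be longer.
    inversionB : ∀ r s → r Fin.< s → List.length (lookup T r) < List.length (lookup T s) →
      ∀ c → 0 < grid T s (suc c) →
      Inversion (grid T s (suc c)) (grid T r c) (grid T s c)
    inversionB r s r<s longer c p = inj₂ (↓ s c , ≰⇒> λ le →
      let lt = atom r s r<s c p le in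
      <⇒≱ (proj₁ (at-alive (positive regular s) _) longer) (≤-trans
        (atom-stays (atom r s r<s) (↓ s)
          (<⇒≤ (proj₂ (at-alive (positive regular r) (suc c)) (≤-<-trans z≤n lt))) (<⇒≤ lt))
        (≤-reflexive (at-length (lookup T r)))))

-- Moving rows

nonempty? : (xs : List ℕ) → Dec (List.length xs ≢ 0)
nonempty? xs = ¬? (List.length xs ≟ 0)

rows : ∀ {n} → Filling n → List (List ℕ)
rows T = List.filter nonempty? (toList T)

flat-lengths : ∀ {n} (T : Filling n) → flat (lengths T) ≡ List.map List.length (rows T)
flat-lengths []             = refl
flat-lengths ([] ∷ T)       = flat-lengths T
flat-lengths ((x ∷ xs) ∷ T) = cong (_ ∷_) (flat-lengths T)

sum-rows : ∀ {n} (g : List ℕ → ℕ) → g [] ≡ 0 → (T : Filling n) →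
           sumᶠ (λ r → g (lookup T r)) ≡ sum (List.map g (rows T))
sum-rows g g[] []             = refl
sum-rows g g[] ([] ∷ T)       = cong₂ _+_ g[] (sum-rows g g[] T)
sum-rows g g[] ((x ∷ xs) ∷ T) = cong (g (x ∷ xs) +_) (sum-rows g g[] T)

sum-same-rows : ∀ {n} {T S : Filling n} → rows T ≡ rows S → (g : List ℕ → ℕ) → g [] ≡ 0 →
                sumᶠ (λ r → g (lookup T r)) ≡ sumᶠ (λ r → g (lookup S r))
sum-same-rows {T = T} {S} e g g[] =
  trans (sum-rows g g[] T) (trans (cong (sum ∘ List.map g) e) (sym (sum-rows g g[] S)))

same-rows⇒∼ : ∀ {n} {T S : Filling n} → rows T ≡ rows S → grid T ∼ grid S
same-rows⇒∼ {T = T} {S} e c .sums f f0 = sum-same-rows {T = T} {S} e (λ xs → f (at xs c)) f0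

module _ {P : List ℕ → Set} where

  all⇒rows : ∀ {n} (T : Filling n) →
             (∀ r → 0 < List.length (lookup T r) → P (lookup T r)) → All P (rows T)
  all⇒rows []             h = []
  all⇒rows ([] ∷ T)       h = all⇒rows T (h ∘ suc)
  all⇒rows ((x ∷ xs) ∷ T) h = h zero z<s ∷ all⇒rows T (h ∘ suc)

  rows⇒all : P [] → ∀ {n} (T : Filling n) → All P (rows T) → ∀ r → P (lookup T r)
  rows⇒all p[] ([] ∷ T)       ps       zero    = p[]
  rows⇒all p[] ([] ∷ T)       ps       (suc r) = rows⇒all p[] T ps r
  rows⇒all p[] ((x ∷ xs) ∷ T) (p ∷ ps) zero    = p
  rows⇒all p[] ((x ∷ xs) ∷ T) (p ∷ ps) (suc r) = rows⇒all p[] T ps r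

module _ {P : List ℕ → List ℕ → Set} where

  pairwise⇒rows : ∀ {n} (T : Filling n) → Pairwise P (lookup T) → AllPairs P (rows T)
  pairwise⇒rows []             h = []
  pairwise⇒rows ([] ∷ T)       h = pairwise⇒rows T (λ r s lt → h (suc r) (suc s) (s≤s lt))
  pairwise⇒rows ((x ∷ xs) ∷ T) h = all⇒rows T (λ s _ → h zero (suc s) z<s)
    ∷ pairwise⇒rows T (λ r s lt → h (suc r) (suc s) (s≤s lt))

  rows⇒pairwise : (∀ ys → P [] ys) → (∀ xs → P xs []) →
                  ∀ {n} (T : Filling n) → AllPairs P (rows T) → Pairwise P (lookup T)
  rows⇒pairwise l r ([] ∷ T)       ps       zero    (suc s) lt       = l _
  rows⇒pairwise l r ([] ∷ T)       ps       (suc i) (suc s) (s≤s lt) = rows⇒pairwise l r T ps i s lt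
  rows⇒pairwise l r ((x ∷ xs) ∷ T) (p ∷ ps) zero    (suc s) lt       = rows⇒all (r _) T p s
  rows⇒pairwise l r ((x ∷ xs) ∷ T) (p ∷ ps) (suc i) (suc s) (s≤s lt) = rows⇒pairwise l r T ps i s lt

quasiPair-emptyˡ : ∀ g → QuasiPair (at []) g
quasiPair-emptyˡ g = record
  { distinct = λ c p e → <⇒≢ p e
  ; descent  = λ c p lt → ⊥-elim (n≮0 lt)
  ; longer   = λ ℓ _ _ c p → ⊥-elim (n≮0 p) }

quasiPair-emptyʳ : ∀ f → QuasiPair f (at [])
quasiPair-emptyʳ f = record
  { distinct = λ c p → ⊥-elim (n≮0 p)
  ; descent  = λ c p → ⊥-elim (n≮0 p)
  ; longer   = λ ℓ _ p → ⊥-elim (n≮0 p) }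

module _ {n} {T S : Filling n} (e : rows T ≡ rows S) where

  transport-regular : Regular T → Regular S
  transport-regular reg = record
    { positive = rows⇒all [] S (subst (All Positive) e (all⇒rows T (λ r _ → positive reg r)))
    ; linked   = rows⇒all [] S (subst (All (Linked _≥_)) e (all⇒rows T (λ r _ → linked reg r))) }

  transport-quasi : Pairwise QuasiPair (grid T) → Pairwise QuasiPair (grid S)
  transport-quasi q = rows⇒pairwise (λ _ → quasiPair-emptyˡ _) (λ _ → quasiPair-emptyʳ _) S
    (subst (AllPairs (λ xs ys → QuasiPair (at xs) (at ys))) e (pairwise⇒rows T q))

  transport-first : Pairwise FirstPair (grid T) → Pairwise FirstPair (grid S)
  transport-first q = rows⇒pairwise (λ _ p → ⊥-elim (n≮0 p)) (λ _ _ p → ⊥-elim (n≮0 p)) S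
    (subst (AllPairs (λ xs ys → FirstPair (at xs) (at ys))) e (pairwise⇒rows T q))

-- `k` rows are already laid out and `n` remain. The next row, labelled `suc k`, takes the head of
-- `L` if that starts with `suc k` and is left empty otherwise; increasing first entries keep the
-- bounds valid for the rest.
place : ∀ n k L → All (λ xs → k < at xs 0 × at xs 0 ≤ k + n) L →
        AllPairs (λ xs ys → FirstPair (at xs) (at ys)) L →
        ∃[ V ] rows {n} V ≡ L × ∀ r → 0 < grid V r 0 → grid V r 0 ≡ suc (k + toℕ r)
place zero    k []       _                _ = [] , refl , λ ()
place zero    k (xs ∷ L) ((lt , le) ∷ _)  _ = ⊥-elim (<⇒≱ lt (subst (at xs 0 ≤_) (+-identityʳ k) le))
place (suc n) k []       _                _ =
  let V , e , h = place n (suc k) [] [] []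
  in [] ∷ V , e , λ { zero () ; (suc r) p → trans (h r p) (cong suc (sym (+-suc k (toℕ r)))) }
place (suc n) k ([] ∷ L) ((() , _) ∷ _) _
place (suc n) k ((x ∷ xs) ∷ L) ((lt , le) ∷ bs) (ps ∷ pss) with x ≟ suc k
... | yes refl =
  let V , e , h = place n (suc k) L
        (All.zipWith (λ { {ys} (q , (lt′ , le′)) →
            q z<s (≤-<-trans z≤n lt′) , subst (at ys 0 ≤_) (+-suc k n) le′ }) (ps , bs)) pss
  in (x ∷ xs) ∷ V , cong (_ ∷_) e , λ
    { zero    _ → cong suc (sym (+-identityʳ k))
    ; (suc r) p → trans (h r p) (cong suc (sym (+-suc k (toℕ r)))) }
... | no x≢ =
  let x> = ≤∧≢⇒< lt (x≢ ∘ sym)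
      V , e , h = place n (suc k) ((x ∷ xs) ∷ L)
        ((x> , subst (x ≤_) (+-suc k n) le)
          ∷ All.zipWith (λ { {ys} (q , (lt′ , le′)) →
              <-trans x> (q (≤-<-trans z≤n lt) (≤-<-trans z≤n lt′)) ,
              subst (at ys 0 ≤_) (+-suc k n) le′ }) (ps , bs))
        (ps ∷ pss)
  in [] ∷ V , e , λ { zero () ; (suc r) p → trans (h r p) (cong suc (sym (+-suc k (toℕ r)))) }

fill : ∀ {n} (a : WeakComposition n) L → flat a ≡ List.map List.length L →
       ∃[ T ] rows T ≡ L × lengths T ≡ a
fill []          []             e = [] , refl , refl
fill (zero  ∷ a) L              e = let T , e₁ , e₂ = fill a L e in [] ∷ T , e₁ , cong (0 ∷_) e₂
fill (suc k ∷ a) ((x ∷ xs) ∷ L) e =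
  let e₀ , e′ = List.∷-injective e
      T , e₁ , e₂ = fill a L e′
  in (x ∷ xs) ∷ T , cong (_ ∷_) e₁ , cong₂ _∷_ (sym e₀) e₂

-- Dominance and the bound on first entries

sumᶠ-zero : ∀ n → sumᶠ {n} (λ _ → 0) ≡ 0
sumᶠ-zero zero    = refl
sumᶠ-zero (suc n) = sumᶠ-zero n

sum-take : ∀ {n} (T : Filling n) j →
  sum (List.take j (toList (lengths T))) ≡ sumᶠ (λ r → [ toℕ r <? j ] * List.length (lookup T r))
sum-take {n} T  zero    = sym (sumᶠ-zero n)
sum-take []       (suc j) = refl
sum-take (xs ∷ T) (suc j) = cong₂ _+_ (sym (+-identityʳ _)) (sum-take T j)

module _ {n} {T V : Filling n} (T-reg : Regular T) (V-anch : Anchored (grid V))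
         (e : rows T ≡ rows V) where

  private
    V-reg : Regular V
    V-reg = transport-regular {T = T} {V} e T-reg

    -- Summed over all rows this depends only on the nonempty rows, hence agrees for `T` and `V`;
    -- for the anchored `V` it gives the partial sum of the lengths up to row `i`.
    startsBy : Fin n → List ℕ → ℕ
    startsBy i xs = [ at xs 0 ≤? label i ] * List.length xs

    startsBy-T≡V : ∀ i → sumᶠ (λ r → startsBy i (lookup T r)) ≡ sumᶠ (λ r → startsBy i (lookup V r))
    startsBy-T≡V i = sum-same-rows {T = T} {V} e (startsBy i) refl

    empty-or-alive : ∀ {xs} → Positive xs → xs ≡ [] ⊎ 0 < at xs 0
    empty-or-alive []      = inj₁ refl
    empty-or-alive (p ∷ _) = inj₂ p

  -- Each nonempty row of `T` up to `i` starts with at most `label i`, so `startsBy` counts it.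
  bounded⇒⊵ : (∀ r → grid T r 0 ≤ label r) → lengths V ⊵ lengths T
  bounded⇒⊵ bounded i = begin
    partialSum (lengths T) i ≡⟨ sum-take T (label i) ⟩
    sumᶠ (λ r → [ toℕ r <? label i ] * List.length (lookup T r))
      ≤⟨ sumᶠ-mono (λ r → *-monoˡ-≤ (List.length (lookup T r))
           ([]-mono (≤-trans (bounded r)) (toℕ r <? label i) (grid T r 0 ≤? label i))) ⟩
    sumᶠ (λ r → startsBy i (lookup T r)) ≡⟨ startsBy-T≡V i ⟩
    sumᶠ (λ r → startsBy i (lookup V r)) ≤⟨ sumᶠ-mono early ⟩
    sumᶠ (λ r → [ toℕ r <? label i ] * List.length (lookup V r)) ≡⟨ sum-take V (label i) ⟨
    partialSum (lengths V) i ∎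
    where
    open ≤-Reasoning
    early : ∀ r → startsBy i (lookup V r) ≤ [ toℕ r <? label i ] * List.length (lookup V r)
    early r with empty-or-alive (positive V-reg r)
    ... | inj₁ eq = subst (λ xs → startsBy i xs ≤ [ toℕ r <? label i ] * List.length xs) (sym eq) z≤n
    ... | inj₂ p  = *-monoˡ-≤ (List.length (lookup V r))
      ([]-mono (subst (_≤ label i) (V-anch r p)) (grid V r 0 ≤? label i) (toℕ r <? label i))

  -- If row `r` starts too large, so do all nonempty rows above it, since first entries increase.
  -- Then `startsBy` counts only rows of `T` strictly below `r`, and the partial sum of `T`, which
  -- includes row `r`, exceeds that of `V`.
  ⊵⇒bounded : Pairwise FirstPair (grid T) → lengths V ⊵ lengths T → ∀ r → grid T r 0 ≤ label r
  ⊵⇒bounded first dom r = ≮⇒≥ λ late → <⇒≱ (contra late) (dom r)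
    where
    open ≤-Reasoning
    late-rows : label r < grid T r 0 → ∀ s →
      startsBy r (lookup T s) ≤ [ toℕ s <? label r ] * List.length (lookup T s)
    late-rows late s with empty-or-alive (positive T-reg s)
    ... | inj₁ eq = subst (λ xs → startsBy r xs ≤ [ toℕ s <? label r ] * List.length xs) (sym eq) z≤n
    ... | inj₂ p  = *-monoˡ-≤ (List.length (lookup T s)) ([]-mono
      (λ le → ≰⇒> λ r<s → <⇒≱ (<-trans late (first r s r<s (≤-<-trans z≤n late) p)) le)
      (grid T s 0 ≤? label r) (toℕ s <? label r))
    on-time : ∀ s → toℕ s < label r → grid V s 0 ≤ label r
    on-time s lt with 0 <? grid V s 0
    ... | yes p = subst (_≤ label r) (sym (V-anch s p)) lt
    ... | no ¬p = ≤-trans (≮⇒≥ ¬p) z≤n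
    contra : label r < grid T r 0 → partialSum (lengths V) r < partialSum (lengths T) r
    contra late = begin-strict
      partialSum (lengths V) r ≡⟨ sum-take V (label r) ⟩
      sumᶠ (λ s → [ toℕ s <? label r ] * List.length (lookup V s))
        ≤⟨ sumᶠ-mono (λ s → *-monoˡ-≤ (List.length (lookup V s))
             ([]-mono (on-time s) (toℕ s <? label r) (grid V s 0 ≤? label r))) ⟩
      sumᶠ (λ s → startsBy r (lookup V s)) ≡⟨ startsBy-T≡V r ⟨
      sumᶠ (λ s → startsBy r (lookup T s))
        <⟨ sumᶠ-mono-< (late-rows late) r (begin-strict
             startsBy r (lookup T r)
               ≤⟨ *-monoˡ-≤ (List.length (lookup T r))
                    ([]-mono (<⇒≱ late) (grid T r 0 ≤? label r) (no id)) ⟩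
             0 <⟨ proj₂ (at-alive (positive T-reg r) 0) (≤-<-trans z≤n late) ⟩
             List.length (lookup T r) ≡⟨ *-identityˡ _ ⟨
             1 * List.length (lookup T r)
               ≤⟨ *-monoˡ-≤ (List.length (lookup T r))
                    ([]-mono (λ _ → ≤-refl) (yes tt) (toℕ r <? label r)) ⟩
             [ toℕ r <? label r ] * List.length (lookup T r) ∎) ⟩
      sumᶠ (λ s → [ toℕ s <? label r ] * List.length (lookup T s)) ≡⟨ sum-take T (label r) ⟨
      partialSum (lengths T) r ∎

-- The correspondence

longest : ∀ {n} → Filling n → ℕ
longest T = sumᶠ λ r → List.length (lookup T r)

grid-end : ∀ {n} {T : Filling n} → Regular T → ∀ {K} → longest T ≤ K → ∀ r → grid T r K ≡ 0
grid-end {T = T} reg le r =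
  antitone-zero (antitones reg r) (≤-trans (≤sumᶠ _ r) le) (at-length (lookup T r))

module _ {n} {F : Grid n} (F↓ : Antitones F) (K : ℕ) (end : ∀ r → F r K ≡ 0) where

  fromGrid : Filling n
  fromGrid = Vec.tabulate λ r → support K (F r)

  fromGrid-regular : Regular fromGrid
  fromGrid-regular = record
    { positive = λ r → subst Positive (sym (Vec.lookup∘tabulate _ r)) (support-positive K (F r))
    ; linked   = λ r → subst (Linked _≥_) (sym (Vec.lookup∘tabulate _ r))
        (antitone-linked _ λ c → subst₂ _≤_ (sym (at-support (F↓ r) K (end r) (suc c)))
                                            (sym (at-support (F↓ r) K (end r) c)) (F↓ r c)) }

  grid-fromGrid : ∀ r c → grid fromGrid r c ≡ F r c
  grid-fromGrid r c = trans (cong (λ xs → at xs c) (Vec.lookup∘tabulate _ r))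
    (at-support (F↓ r) K (end r) c)

same-lengths : ∀ {n} {T S : Filling n} → Regular T → Regular S →
  (∀ r c → (0 < grid T r c → 0 < grid S r c) × (0 < grid S r c → 0 < grid T r c)) →
  lengths T ≡ lengths S
same-lengths {T = []}     {[]}     _ _ h = refl
same-lengths {T = xs ∷ T} {ys ∷ S} t s h = cong₂ _∷_
  (same-length (positive t zero) (positive s zero) (h zero))
  (same-lengths {T = T} {S}
    (record { positive = positive t ∘ suc ; linked = linked t ∘ suc })
    (record { positive = positive s ∘ suc ; linked = linked s ∘ suc }) (h ∘ suc))

anchored-first : ∀ {n} {F : Grid n} → Anchored F → Pairwise FirstPair F
anchored-first h r s r<s p q = subst₂ _<_ (sym (h r p)) (sym (h s q)) (s≤s r<s)

AtomPair-resp : ∀ {f f′ g g′} → (∀ c → f c ≡ f′ c) → (∀ c → g c ≡ g′ c) →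
                AtomPair f g → AtomPair f′ g′
AtomPair-resp e e′ h c p le = subst₂ _<_ (e′ _) (e _)
  (h c (subst (0 <_) (sym (e′ _)) p) (subst₂ _≤_ (sym (e′ _)) (sym (e _)) le))

QuasiPair-resp : ∀ {f f′ g g′} → (∀ c → f c ≡ f′ c) → (∀ c → g c ≡ g′ c) →
                 QuasiPair f g → QuasiPair f′ g′
QuasiPair-resp e e′ h = record
  { distinct = λ c p eq → distinct c (subst (0 <_) (sym (e′ _)) p) (trans (e c) (trans eq (sym (e′ c))))
  ; descent  = λ c p lt → subst₂ _<_ (e′ _) (e _)
      (descent c (subst (0 <_) (sym (e′ _)) p) (subst₂ _<_ (sym (e′ _)) (sym (e _)) lt))
  ; longer   = λ ℓ eq p c q → subst₂ _<_ (e _) (e′ _)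
      (longer ℓ (trans (e ℓ) eq) (subst (0 <_) (sym (e′ _)) p) c (subst (0 <_) (sym (e _)) q)) }
  where open QuasiPair h

opaque

  atom-counterpart : ∀ {n} {V : Filling n} →
    Regular V → Pairwise QuasiPair (grid V) → Anchored (grid V) →
    ∃[ S ] IsAtom S × grid V ∼ grid S × lengths V ≡ lengths S
  atom-counterpart {n} {V} reg quasi anchored
    with G , G↓ , G-distinct , G-atom , V∼G , V₀ ← atom-exists (antitones reg)
           (distinctPair⇒distinct λ r s r<s → QuasiPair.distinct (quasi r s r<s))
    = S , S-atom , ∼-trans V∼G (λ c → ≈ᶜ-sym (≈ᶜ-reflexive λ r → S≡G r c))
    , same-lengths {T = V} {S} reg S-regular shape
    where
    G-anchored : Anchored G
    G-anchored r p = trans (sym (V₀ r)) (anchored r (subst (0 <_) (sym (V₀ r)) p))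
    V≈G : ∀ r c → (0 < grid V r c → 0 < G r c) × (0 < G r c → 0 < grid V r c)
    V≈G = same-shape (antitones reg) G↓ quasi G-atom V∼G V₀ G-anchored
    K : ℕ
    K = longest V
    end : ∀ r → G r K ≡ 0
    end r = n≤0⇒n≡0 (≮⇒≥ λ p → <⇒≢ (proj₂ (V≈G r K) p) (sym (grid-end reg ≤-refl r)))
    S : Filling n
    S = fromGrid G↓ K end
    S-regular : Regular S
    S-regular = fromGrid-regular G↓ K end
    S≡G : ∀ r c → grid S r c ≡ G r c
    S≡G = grid-fromGrid G↓ K end
    shape : ∀ r c → (0 < grid V r c → 0 < grid S r c) × (0 < grid S r c → 0 < grid V r c)
    shape r c = subst (λ x → (0 < grid V r c → 0 < x) × (0 < x → 0 < grid V r c))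
      (sym (S≡G r c)) (V≈G r c)
    S-atom : IsAtom S
    S-atom = record
      { regular  = S-regular
      ; distinct = λ c r s p e → G-distinct c r s (subst (0 <_) (S≡G r c) p)
          (trans (sym (S≡G r c)) (trans e (S≡G s c)))
      ; atom     = λ r s r<s → AtomPair-resp (sym ∘ S≡G r) (sym ∘ S≡G s) (G-atom r s r<s)
      ; anchored = λ r p → trans (S≡G r 0) (G-anchored r (subst (0 <_) (S≡G r 0) p)) }

opaque

  quasi-counterpart : ∀ {n} {S : Filling n} → IsAtom S →
    ∃[ V ] Regular V × Pairwise QuasiPair (grid V) × Anchored (grid V) ×
           grid V ∼ grid S × lengths V ≡ lengths S
  quasi-counterpart {n} {S} atomic
    with G , G↓ , G-quasi , G∼S , G₀ ← quasi-exists {K = longest S}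
           (antitones (IsAtom.regular atomic)) (IsAtom.distinct atomic)
           (grid-end (IsAtom.regular atomic) ≤-refl) (anchored-first {F = grid S} (IsAtom.anchored atomic))
    = V , V-regular , (λ r s r<s → QuasiPair-resp (sym ∘ V≡G r) (sym ∘ V≡G s) (G-quasi r s r<s))
    , (λ r p → trans (V≡G r 0) (trans (G₀ r) (anchored r (subst (0 <_) (trans (V≡G r 0) (G₀ r)) p))))
    , ∼-trans (λ c → ≈ᶜ-reflexive λ r → V≡G r c) G∼S , same-lengths {T = V} {S} V-regular regular shape
    where
    open IsAtom atomic
    G≈S : ∀ r c → (0 < G r c → 0 < grid S r c) × (0 < grid S r c → 0 < G r c)
    G≈S = same-shape G↓ (antitones regular) G-quasi atom G∼S G₀ anchored
    K : ℕ
    K = longest S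
    end : ∀ r → G r K ≡ 0
    end r = n≤0⇒n≡0 (≮⇒≥ λ p → <⇒≢ (proj₁ (G≈S r K) p) (sym (grid-end regular ≤-refl r)))
    V : Filling n
    V = fromGrid G↓ K end
    V-regular : Regular V
    V-regular = fromGrid-regular G↓ K end
    V≡G : ∀ r c → grid V r c ≡ G r c
    V≡G = grid-fromGrid G↓ K end
    shape : ∀ r c → (0 < grid V r c → 0 < grid S r c) × (0 < grid S r c → 0 < grid V r c)
    shape r c = subst (λ x → (0 < x → 0 < grid S r c) × (0 < grid S r c → 0 < x))
      (sym (V≡G r c)) (G≈S r c)

quasi⇒atom : ∀ {n} {T : Filling n} → IsQuasi T →
  ∃[ S ] IsAtom S × grid T ∼ grid S × Above (lengths T) (lengths S)
quasi⇒atom {n} {T} q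
  with V , V-rows , V-anchored ← place n 0 (rows T)
         (all⇒rows T λ r p → proj₁ (at-alive (positive (IsQuasi.regular q) r) 0) p
                           , ≤-trans (IsQuasi.bounded q r) (Fin.toℕ<n r))
         (pairwise⇒rows T (IsQuasi.first q))
  with S , S-atom , V∼S , V-lengths ← atom-counterpart {V = V}
         (transport-regular {T = T} {V} (sym V-rows) (IsQuasi.regular q))
         (transport-quasi {T = T} {V} (sym V-rows) (IsQuasi.quasi q)) V-anchored
  = S , S-atom , ∼-trans (same-rows⇒∼ {T = T} {V} (sym V-rows)) V∼S , record
    { dominates = subst (_⊵ lengths T) V-lengths
        (bounded⇒⊵ {T = T} {V} (IsQuasi.regular q) V-anchored (sym V-rows) (IsQuasi.bounded q))
    ; sameFlat  = trans (cong flat (sym V-lengths))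
        (trans (flat-lengths V) (trans (cong (List.map List.length) V-rows) (sym (flat-lengths T)))) }

-- `V` satisfies the quasi-key pair conditions with each row at its label. Equal `flat` lets its
-- rows be redistributed over the shape `a`; the pair conditions survive because they hold trivially
-- for empty rows, and dominance supplies the row bound.
atom⇒quasi : ∀ {n} {a : WeakComposition n} {S : Filling n} → IsAtom S → Above a (lengths S) →
  ∃[ T ] IsQuasi T × grid T ∼ grid S × lengths T ≡ a
atom⇒quasi {n} {a} {S} atomic above
  with V , V-regular , V-quasi , V-anchored , V∼S , V-lengths ← quasi-counterpart atomic
  with T , T-rows , T-lengths ← fill a (rows V)
         (trans (sym (Above.sameFlat above)) (trans (cong flat (sym V-lengths)) (flat-lengths V)))
  = T , record
    { regular = T-regular
    ; quasi   = transport-quasi {T = V} {T} (sym T-rows) V-quasi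
    ; first   = T-first
    ; bounded = ⊵⇒bounded {T = T} {V} T-regular V-anchored T-rows T-first
        (subst₂ _⊵_ (sym V-lengths) (sym T-lengths) (Above.dominates above)) }
  , ∼-trans (same-rows⇒∼ {T = T} {V} T-rows) V∼S , T-lengths
  where
  T-regular : Regular T
  T-regular = transport-regular {T = V} {T} (sym T-rows) V-regular
  T-first : Pairwise FirstPair (grid T)
  T-first = transport-first {T = V} {T} (sym T-rows) (anchored-first {F = grid V} V-anchored)

-- Uniqueness of fillings with given columns

grid-injective : ∀ {n} {T S : Filling n} → Regular T → Regular S →
                 (∀ r c → grid T r c ≡ grid S r c) → T ≡ S
grid-injective {T = []}     {[]}     t s h = refl
grid-injective {T = xs ∷ T} {ys ∷ S} t s h = cong₂ _∷_
  (at-injective (positive t zero) (positive s zero) (h zero))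
  (grid-injective
    (record { positive = positive t ∘ suc ; linked = linked t ∘ suc })
    (record { positive = positive s ∘ suc ; linked = linked s ∘ suc }) (h ∘ suc))

isQuasi-unique : ∀ {n} {T T′ : Filling n} → IsQuasi T → IsQuasi T′ → lengths T ≡ lengths T′ →
                 grid T ∼ grid T′ → T ≡ T′
isQuasi-unique {n} {T} {T′} q q′ e T∼T′ = grid-injective (IsQuasi.regular q) (IsQuasi.regular q′)
  (quasi-unique (λ r → List.length (lookup T r))
    (antitones (IsQuasi.regular q)) (antitones (IsQuasi.regular q′))
    (IsQuasi.quasi q) (IsQuasi.quasi q′) T∼T′
    (λ r → at-alive (positive (IsQuasi.regular q) r))
    (λ r c → subst (λ l → (c < l → 0 < grid T′ r c) × (0 < grid T′ r c → c < l)) (sym (len r))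
               (at-alive (positive (IsQuasi.regular q′) r) c)))
  where
  len : ∀ r → List.length (lookup T r) ≡ List.length (lookup T′ r)
  len r = trans (sym (Vec.lookup-map r List.length T))
    (trans (cong (λ b → lookup b r) e) (Vec.lookup-map r List.length T′))

≈ᶜ-occurs : ∀ {n} {Y Z : Fin n → ℕ} → Y ≈ᶜ Z → ∀ r → 0 < Y r → ∃[ s ] Z s ≡ Y r
≈ᶜ-occurs {Y = Y} {Z} Y≈Z r p with Fin.any? (λ s → Z s ≟ Y r)
... | yes found = found
... | no  none  = ⊥-elim (<⇒≢ (#-positive (λ s → Y s ≟ Y r) r refl)
  (sym (trans (≈ᶜ-# (_≟ Y r) (<⇒≢ p) Y≈Z) (#-empty (λ s → Z s ≟ Y r) λ s e → none (s , e)))))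

-- The value `F r 0` is the label of `r`; it occurs in the first column of `G`, and anchoring leaves
-- row `r` as its only place.
anchored-∼ : ∀ {n} {F G : Grid n} → Anchored F → Anchored G → F ∼ G → ∀ r → 0 < F r 0 → F r 0 ≡ G r 0
anchored-∼ {F = F} {G} f g F∼G r p with ≈ᶜ-occurs (F∼G 0) r p
... | s , e = trans (sym e) (cong (λ i → G i 0)
  (Fin.toℕ-injective (suc-injective (trans (sym (g s (subst (0 <_) (sym e) p))) (trans e (f r p))))))

anchored-first-∼ : ∀ {n} {F G : Grid n} → Anchored F → Anchored G → F ∼ G → SameFirst F G
anchored-first-∼ {F = F} {G} f g F∼G r with 0 <? F r 0 | 0 <? G r 0
... | yes p | _     = anchored-∼ {F = F} {G} f g F∼G r p
... | no _  | yes q = sym (anchored-∼ {F = G} {F} g f (∼-sym F∼G) r q)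
... | no ¬p | no ¬q = trans (n≤0⇒n≡0 (≮⇒≥ ¬p)) (sym (n≤0⇒n≡0 (≮⇒≥ ¬q)))

isAtom-unique : ∀ {n} {S S′ : Filling n} → IsAtom S → IsAtom S′ → grid S ∼ grid S′ → S ≡ S′
isAtom-unique {S = S} {S′} t t′ S∼S′ = grid-injective T.regular T′.regular
  (atom-unique (antitones T.regular) (antitones T′.regular) T.atom T′.atom S∼S′
    (anchored-first-∼ {F = grid S} {grid S′} T.anchored T′.anchored S∼S′))
  where
  module T = IsAtom t
  module T′ = IsAtom t′

-- Weights

occurrences : ∀ l K xs → List.length xs ≤ K →
  List.length (List.filter (_≟ suc l) xs) ≡ sumᶠ {K} (λ c → [ at xs (toℕ c) ≟ suc l ])
occurrences l K       []       _       = sym (sumᶠ-zero K)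
occurrences l (suc K) (x ∷ xs) (s≤s h) with does (x ≟ suc l)
... | true  = cong suc (occurrences l K xs h)
... | false = occurrences l K xs h

occurrences-concat : ∀ {n} l K (T : Filling n) → (∀ r → List.length (lookup T r) ≤ K) →
  List.length (List.filter (_≟ suc l) (List.concat (toList T))) ≡
  sumᶠ (λ r → sumᶠ {K} (λ c → [ grid T r (toℕ c) ≟ suc l ]))
occurrences-concat l K []       h = refl
occurrences-concat l K (xs ∷ T) h = begin
  List.length (List.filter (_≟ suc l) (xs List.++ List.concat (toList T)))
    ≡⟨ cong List.length (List.filter-++ (_≟ suc l) xs _) ⟩
  List.length (List.filter (_≟ suc l) xs List.++ List.filter (_≟ suc l) (List.concat (toList T)))
    ≡⟨ List.length-++ (List.filter (_≟ suc l) xs) ⟩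
  List.length (List.filter (_≟ suc l) xs) +
    List.length (List.filter (_≟ suc l) (List.concat (toList T)))
    ≡⟨ cong₂ _+_ (occurrences l K xs (h zero)) (occurrences-concat l K T (h ∘ suc)) ⟩
  _ ∎
  where open ≡-Reasoning

-- Occurrences of a label are counted box by box over the rows and `K` columns, `K` being at least
-- every row length of both fillings; after exchanging the sums, each column contributes equally.
∼⇒wt : ∀ {n} {T S : Filling n} → grid T ∼ grid S → wt T ≡ wt S
∼⇒wt {n} {T} {S} T∼S = Vec.tabulate-cong λ i → begin
  List.length (List.filter (_≟ label i) (List.concat (toList T)))
    ≡⟨ occurrences-concat (toℕ i) K T (λ r → ≤-trans (≤sumᶠ _ r) (m≤m+n _ _)) ⟩
  sumᶠ (λ r → sumᶠ {K} (λ c → [ grid T r (toℕ c) ≟ label i ]))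
    ≡⟨ ∑-comm (λ r (c : Fin K) → [ grid T r (toℕ c) ≟ label i ]) ⟩
  sumᶠ {K} (λ c → sumᶠ (λ r → [ grid T r (toℕ c) ≟ label i ]))
    ≡⟨ sum-cong-≗ {K} (λ c → T∼S (toℕ c) .sums (λ x → [ x ≟ label i ]) refl) ⟩
  sumᶠ {K} (λ c → sumᶠ (λ r → [ grid S r (toℕ c) ≟ label i ]))
    ≡⟨ ∑-comm (λ r (c : Fin K) → [ grid S r (toℕ c) ≟ label i ]) ⟨
  sumᶠ (λ r → sumᶠ {K} (λ c → [ grid S r (toℕ c) ≟ label i ]))
    ≡⟨ occurrences-concat (toℕ i) K S (λ r → ≤-trans (≤sumᶠ _ r) (m≤n+m _ _)) ⟨
  List.length (List.filter (_≟ label i) (List.concat (toList S))) ∎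
  where
  open ≡-Reasoning
  K = longest T + longest S

-- Summation over matched lists

module _ {A B : Set} (_↔_ : A → B → Set) (f : A → ℕ) (g : B → ℕ)
         (f≡g : ∀ {x y} → x ↔ y → f x ≡ g y) where

  -- Stated for a relation instead of mutually inverse maps, so that existence and uniqueness of
  -- partners on each side suffice. The induction removes the head of `xs` together with its partner
  -- in `ys`.
  sum-matching : ∀ {xs ys} → Unique xs → Unique ys →
    (∀ {x} → x ∈ xs → ∃[ y ] y ∈ ys × x ↔ y) → (∀ {y} → y ∈ ys → ∃[ x ] x ∈ xs × x ↔ y) →
    (∀ {x y y′} → y ∈ ys → y′ ∈ ys → x ↔ y → x ↔ y′ → y ≡ y′) →
    (∀ {x x′ y} → x ∈ xs → x′ ∈ xs → x ↔ y → x′ ↔ y → x ≡ x′) →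
    sum (List.map f xs) ≡ sum (List.map g ys)
  sum-matching {[]}     {[]}     _ _ _ _ _ _ = refl
  sum-matching {[]}     {y ∷ ys} _ _ _ r _ _ with () ← proj₁ (proj₂ (r (here refl)))
  sum-matching {x ∷ xs} {ys} (x∉ ∷ u) u′ l r functional injective
    with y , y∈ , x↔y ← l (here refl)
    with us , vs , refl ← ∈-∃++ y∈
    with p ← shift y us vs
    with y∉ ∷ u″ ← Unique-resp-↭ (setoid B) (↭⇒↭ₛ p) u′
    = trans (cong₂ _+_ (f≡g x↔y) (sum-matching u u″ l′ r′
          (λ q q′ → functional (∈-resp-↭ (↭-sym p) (there q)) (∈-resp-↭ (↭-sym p) (there q′)))
          (λ q q′ → injective (there q) (there q′))))
        (sym (sum-↭ (map⁺ g p)))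
    where
    l′ : ∀ {x′} → x′ ∈ xs → ∃[ y′ ] y′ ∈ us List.++ vs × x′ ↔ y′
    l′ x′∈ with l (there x′∈)
    ... | y′ , y′∈ , x′↔y′ with ∈-resp-↭ p y′∈
    ...   | here refl = ⊥-elim (All.lookup x∉ x′∈ (injective (here refl) (there x′∈) x↔y x′↔y′))
    ...   | there q   = y′ , q , x′↔y′
    r′ : ∀ {y′} → y′ ∈ us List.++ vs → ∃[ x′ ] x′ ∈ xs × x′ ↔ y′
    r′ y′∈ with r (∈-resp-↭ (↭-sym p) (there y′∈))
    ... | x′ , here refl , x′↔y′ = ⊥-elim (All.lookup y∉ y′∈
      (functional y∈ (∈-resp-↭ (↭-sym p) (there y′∈)) x↔y x′↔y′))
    ... | x′ , there q   , x′↔y′ = x′ , q , x′↔y′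

sum-concatMap : ∀ {A B : Set} (g : B → ℕ) (h : A → List B) xs →
  sum (List.map (λ x → sum (List.map g (h x))) xs) ≡ sum (List.map g (List.concatMap h xs))
sum-concatMap g h []       = refl
sum-concatMap g h (x ∷ xs) = trans (cong (_ +_) (sum-concatMap g h xs))
  (trans (sym (sum-++ (List.map g (h x)) _)) (cong sum (sym (List.map-++ g (h x) _))))

module _ {n} (a : WeakComposition n) where

  open Listing

  atomsAbove : List (Filling n)
  atomsAbove = List.concatMap (elements ∘ atomFillings) (elements (compositionsAbove a))

  ∈-atomsAbove⁺ : ∀ {b S} → Above a b → IsAtomFilling b S → S ∈ atomsAbove
  ∈-atomsAbove⁺ {b} p q = ∈-concat⁺′ (complete (atomFillings b) q)
    (∈-map⁺ (elements ∘ atomFillings) (complete (compositionsAbove a) p))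

  ∈-atomsAbove⁻ : ∀ {S} → S ∈ atomsAbove → ∃[ b ] Above a b × IsAtomFilling b S
  ∈-atomsAbove⁻ S∈ with ∈-concat⁻′ _ S∈
  ... | _ , S∈b , b∈ with ∈-map⁻ (elements ∘ atomFillings) b∈
  ...   | b , b∈′ , refl = b , sound (compositionsAbove a) b∈′ , sound (atomFillings b) S∈b

  atomsAbove-unique : Unique atomsAbove
  atomsAbove-unique = Unique.concat⁺
    (All.map⁺ (All.universal (unique ∘ atomFillings) _))
    (AllPairs.map⁺ (AllPairs.map disjoint (unique (compositionsAbove a))))
    where
    -- A filling determines its shape, hence the composition it comes from.
    disjoint : ∀ {b c} → b ≢ c → Disjoint (elements (atomFillings b)) (elements (atomFillings c))
    disjoint b≢c (p , q) = b≢c (trans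
      (sym (shape (sound (atomFillings _) p))) (shape (sound (atomFillings _) q)))
      where
      shape : ∀ {b S} → IsAtomFilling b S → lengths S ≡ b
      shape = IsFilling.shape ∘ IsAtomFilling.isFilling

theorem3p4 : ∀ (n : ℕ) (a : WeakComposition n) → 𝔔 a ≗ ∑ (compositionsAbove a) 𝒜
theorem3p4 n a v = trans
  (sum-matching (λ T S → grid T ∼ grid S) (λ T → (x^ wt T) v) (λ S → (x^ wt S) v)
    (λ {T} {S} T∼S → cong (λ w → (x^ w) v) (∼⇒wt {T = T} {S} T∼S))
    {elements (quasiKeyTableaux a)} {atomsAbove a}
    (unique (quasiKeyTableaux a)) (atomsAbove-unique a) toAtom toQuasi
    (λ S∈ S′∈ T∼S T∼S′ → isAtom-unique (atomic S∈) (atomic S′∈) (∼-trans (∼-sym T∼S) T∼S′))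
    (λ T∈ T′∈ T∼S T′∼S → isQuasi-unique (quasi T∈) (quasi T′∈) (trans (shape T∈) (sym (shape T′∈)))
      (∼-trans T∼S (∼-sym T′∼S))))
  (sym (sum-concatMap (λ S → (x^ wt S) v) (elements ∘ atomFillings) (elements (compositionsAbove a))))
  where
  open Listing
  quasi : ∀ {T} → T ∈ elements (quasiKeyTableaux a) → IsQuasi T
  quasi T∈ = isQuasiKey⇒isQuasi (sound (quasiKeyTableaux a) T∈)
  shape : ∀ {T} → T ∈ elements (quasiKeyTableaux a) → lengths T ≡ a
  shape T∈ = IsFilling.shape (IsQuasiKey.isFilling (sound (quasiKeyTableaux a) T∈))
  atomic : ∀ {S} → S ∈ atomsAbove a → IsAtom S
  atomic S∈ = isAtomFilling⇒isAtom (proj₂ (proj₂ (∈-atomsAbove⁻ a S∈)))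

  toAtom : ∀ {T} → T ∈ elements (quasiKeyTableaux a) → ∃[ S ] S ∈ atomsAbove a × grid T ∼ grid S
  toAtom T∈ =
    let S , S-atom , T∼S , above = quasi⇒atom (quasi T∈)
        above′ = subst (λ b → Above b (lengths S)) (shape T∈) above
    in S , ∈-atomsAbove⁺ a above′ (isAtom⇒isAtomFilling S-atom refl) , T∼S

  toQuasi : ∀ {S} → S ∈ atomsAbove a → ∃[ T ] T ∈ elements (quasiKeyTableaux a) × grid T ∼ grid S
  toQuasi S∈ =
    let b , above , S-atom = ∈-atomsAbove⁻ a S∈
        above′ = subst (Above a) (sym (IsFilling.shape (IsAtomFilling.isFilling S-atom))) above
        T , T-quasi , T∼S , T-shape = atom⇒quasi (isAtomFilling⇒isAtom S-atom) above′
    in T , complete (quasiKeyTableaux a) (isQuasi⇒isQuasiKey T-quasi T-shape) , T∼S
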